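{- For every integer $k\ge 0$, $|I_k(123,231)|$ equals the number of fountains of $k$ coins in which the missing coins with respect to the full triangular fountain (with the same bottom row) form a rectangle, where removing no coins counts as a rectangle. The generating function $\sum_{k\ge 0}|I_k(123,231)|x^k$ is given by \[\sum_{i\ge 1} x^{\binom{i}{2}}+\sum_{i\ge 1}\sum_{j\ge 1}\sum_{\ell=0}^{\min(i,j)-1} x^{\binom{i+1}{2}+\binom{j+1}{2}-\binom{\ell+1}{2}}.\]
   Context: A permutation of length $n$ is a word $\pi=\pi_1\cdots\pi_n$ containing each of $1,\dots,n$ exactly once. The sum of permutations $\rho=\rho_1\cdots\rho_n$ and $\tau=\tau_1\cdots\tau_m$ is the permutation $\rho\oplus\tau=\rho_1\cdots\rho_n(n+\tau_1)\cdots(n+\tau_m)$ of length $n+m$. A permutation is decomposable if it equals $\rho\oplus\tau$ for some non-empty permutations $\rho,\tau$; a non-empty permutation that is not decomposable is indecomposable. An inversion of $\pi$ is a pair $(i,j)$ with $i<j$ and $\pi_i>\pi_j$. A permutation $\pi$ contains a permutation (pattern) $\tau=\tau_1\cdots\tau_m$ if there are indices $i_1<\dots<i_m$ such that $\pi_{i_1},\dots,\pi_{i_m}$ is order-isomorphic to $\tau_1,\dots,\tau_m$; otherwise $\pi$ avoids $\tau$. $I_k(\tau_1,\dots,\tau_r)$ denotes the (finite) set of all indecomposable permutations, of any length, with exactly $k$ inversions that avoid all of $\tau_1,\dots,\tau_r$. A fountain of coins is an arrangement of coins in rows such that the bottom row is full (contiguous, without holes) and each coin in a higher row rests on two adjacent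 coins in the row below. Formally, a fountain with $N\ge 0$ coins in the bottom row is a set $F$ of pairs $(h,p)$ of integers (row $h\ge 0$, position $p$ with $1\le p\le N-h$) such that $(0,p)\in F$ for all $1\le p\le N$, and whenever $(h,p)\in F$ with $h\ge 1$ then $(h-1,p)\in F$ and $(h-1,p+1)\in F$. The empty fountain ($N=0$) is allowed. The full triangular fountain with $N$ coins in the bottom row is the set $T_N$ of all $(h,p)$ with $h\ge 0$, $1\le p\le N-h$. The missing coins of $F$ are the elements of $T_N\setminus F$. The coin $(h,p)$ lies on the up-right diagonal numbered $p$ and on the up-left diagonal numbered $p+h$. A set of coins is a rectangle if it is empty or consists of all coins lying on an up-right diagonal with number in $A$ and an up-left diagonal with number in $B$, for some non-empty intervals of integers $A,B\subseteq\{1,\dots,N\}$ with $a\le b$ for all $a\in A$, $b\in B$. -}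

module Defs where

open import Data.Fin.Base as Fin using (Fin; zero; suc)
open import Data.Fin.Patterns using (0F; 1F; 2F)
open import Data.Fin.Permutation as Perm
  using (Permutation′; permutation; _⟨$⟩ʳ_)
open import Data.Fin.Properties as Fin using (+↔⊎)
open import Data.List.Base
  using (List; length; filter; map; upTo; allFin; cartesianProduct)
open import Data.List.Relation.Unary.All using (All)
open import Data.Nat.Base using (ℕ; suc; _+_; _≤_)
open import Data.Nat.ListAction using (sum)
open import Data.Nat.Properties using (_≟_)
open import Data.Product.Base using (Σ-syntax; ∃; ∃-syntax; _×_; _,_; proj₁)
open import Data.Sum.Function.Propositional using (_⊎-↔_)
open import Function.Base using (_on_)
open import Function.Bundles using (_⇔_; Inverse)
open import Function.Properties.Inverse using (↔-sym; ↔-trans)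
open import Level using (Level; 0ℓ)
open import Relation.Binary.Bundles using (Setoid)
import Relation.Binary.Construct.On as On
open import Relation.Binary.PropositionalEquality as ≡ using (_≡_; refl)
open import Relation.Nullary using (Dec; yes; no; ¬_; _×-dec_)
open import Relation.Unary using (Pred; Decidable; Empty; _∈_; _⊆_; _∖_; _≐_)
open import Relation.Unary.Relation.Binary.Equality using (≐-setoid)

------------------------------------------------------------------------
-- Cardinality of a finite set, presented as a setoid

HasCardinality : ∀ {a ℓ} → Setoid a ℓ → ℕ → Set _
HasCardinality S n = Inverse (≡.setoid (Fin n)) S

------------------------------------------------------------------------
-- Permutations
--
-- Positions and values are numbered from 0.

Permutation : Set
Permutation = ∃ Permutation′

size : Permutation → ℕ
size = proj₁

infix 4 _≋_

data _≋_ : Permutation → Permutation → Set where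
  pointwise : ∀ {n} {π σ : Permutation′ n} → π Perm.≈ σ → (n , π) ≋ (n , σ)

permutationSetoid : Setoid 0ℓ 0ℓ
permutationSetoid = record
  { Carrier       = Permutation
  ; _≈_           = _≋_
  ; isEquivalence = record
    { refl  = pointwise (λ _ → refl)
    ; sym   = λ { (pointwise e) → pointwise (λ i → ≡.sym (e i)) }
    ; trans = λ { (pointwise e) (pointwise f) →
                    pointwise (λ i → ≡.trans (e i) (f i)) }
    }
  }

infixl 6 _⊕_

_⊕_ : Permutation → Permutation → Permutation
(m , ρ) ⊕ (n , τ) =
  m + n , ↔-trans (+↔⊎ {m} {n}) (↔-trans (ρ ⊎-↔ τ) (↔-sym (+↔⊎ {m} {n})))

NonEmpty : Permutation → Set
NonEmpty π = 1 ≤ size π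

Decomposable : Permutation → Set
Decomposable π = ∃[ ρ ] ∃[ τ ] NonEmpty ρ × NonEmpty τ × π ≋ ρ ⊕ τ

Indecomposable : Permutation → Set
Indecomposable π = NonEmpty π × ¬ Decomposable π

Inversion : ∀ {n} → Permutation′ n → Pred (Fin n × Fin n) 0ℓ
Inversion π (i , j) = i Fin.< j × π ⟨$⟩ʳ j Fin.< π ⟨$⟩ʳ i

inversion? : ∀ {n} (π : Permutation′ n) → Decidable (Inversion π)
inversion? π (i , j) = (i Fin.<? j) ×-dec (π ⟨$⟩ʳ j Fin.<? π ⟨$⟩ʳ i)

inversions : Permutation → ℕ
inversions (n , π) =
  length (filter (inversion? π) (cartesianProduct (allFin n) (allFin n)))

Contains : Permutation → Permutation → Set
Contains (n , π) (m , τ) = Σ[ f ∈ (Fin m → Fin n) ]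
  (∀ {a b} → a Fin.< b → f a Fin.< f b) ×
  (∀ a b → (τ ⟨$⟩ʳ a Fin.< τ ⟨$⟩ʳ b) ⇔ (π ⟨$⟩ʳ f a Fin.< π ⟨$⟩ʳ f b))

Avoids : Permutation → Permutation → Set
Avoids π τ = ¬ Contains π τ

InI : ℕ → List Permutation → Pred Permutation 0ℓ
InI k τs π = Indecomposable π × inversions π ≡ k × All (Avoids π) τs

I : ℕ → List Permutation → Setoid 0ℓ 0ℓ
I k τs = On.setoid {B = ∃ (InI k τs)} permutationSetoid proj₁

p123 : Permutation
p123 = 3 , Perm.id

p231 : Permutation
p231 = 3 , permutation to from to-from from-to
  where
  to from : Fin 3 → Fin 3
  to 0F = 1F
  to 1F = 2F
  to 2F = 0F
  from 0F = 2F
  from 1F = 0F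
  from 2F = 1F

  to-from : ∀ i → to (from i) ≡ i
  to-from 0F = refl
  to-from 1F = refl
  to-from 2F = refl

  from-to : ∀ i → from (to i) ≡ i
  from-to 0F = refl
  from-to 1F = refl
  from-to 2F = refl

------------------------------------------------------------------------
-- Fountains of coins

-- (h , p) is the coin in row h at position p.
Coin : Set
Coin = ℕ × ℕ

-- p + h ≤ N instead of p ≤ N ∸ h, so that truncation plays no role.
Triangle : ℕ → Pred Coin 0ℓ
Triangle N (h , p) = 1 ≤ p × p + h ≤ N

record Fountain : Set₁ where
  field
    width     : ℕ
    Coins     : Pred Coin 0ℓ
    coin?     : Decidable Coins
    inside    : Coins ⊆ Triangle width
    bottom    : ∀ {p} → 1 ≤ p → p ≤ width → (0 , p) ∈ Coins
    supported : ∀ {h p} → (suc h , p) ∈ Coins →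
                (h , p) ∈ Coins × (h , suc p) ∈ Coins

  -- Every coin of Triangle width has h < width and 1 ≤ p ≤ width, so the
  -- list below misses no coin.
  coinCount : ℕ
  coinCount =
    length (filter coin? (cartesianProduct (upTo width) (map suc (upTo width))))

  Missing : Pred Coin 0ℓ
  Missing = Triangle width ∖ Coins

upRight : Coin → ℕ
upRight (h , p) = p

upLeft : Coin → ℕ
upLeft (h , p) = p + h

[_⋯_] : ℕ → ℕ → Pred ℕ 0ℓ
[ a ⋯ b ] x = a ≤ x × x ≤ b

data IsRectangle (N : ℕ) (S : Pred Coin 0ℓ) : Set where
  empty   : Empty S → IsRectangle N S
  spanned : ∀ {a₁ a₂ b₁ b₂} →
            a₁ ≤ a₂ → b₁ ≤ b₂ →
            [ a₁ ⋯ a₂ ] ⊆ [ 1 ⋯ N ] → [ b₁ ⋯ b₂ ] ⊆ [ 1 ⋯ N ] →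
            (∀ {a b} → a ∈ [ a₁ ⋯ a₂ ] → b ∈ [ b₁ ⋯ b₂ ] → a ≤ b) →
            S ≐ (λ c → c ∈ Triangle N ×
                       upRight c ∈ [ a₁ ⋯ a₂ ] × upLeft c ∈ [ b₁ ⋯ b₂ ]) →
            IsRectangle N S

IsRectangularFountain : ℕ → Fountain → Set
IsRectangularFountain k F = coinCount ≡ k × IsRectangle width Missing
  where open Fountain F

-- Two fountains are equal when they have the same coins; the width is then
-- the same, being the number of coins in row 0.
RectangularFountains : ℕ → Setoid _ _
RectangularFountains k =
  On.setoid {B = ∃ (IsRectangularFountain k)} (≐-setoid Coin 0ℓ)
            (λ F → Fountain.Coins (proj₁ F))

------------------------------------------------------------------------
-- Formal power series, as sequences of coefficients

Series : Set
Series = ℕ → ℕ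

x^_ : ℕ → Series
(x^ n) k with n ≟ k
... | yes _ = 1
... | no  _ = 0

infixl 6 _⊞_

_⊞_ : Series → Series → Series
(f ⊞ g) k = f k + g k

sumOver : List ℕ → (ℕ → Series) → Series
sumOver is f k = sum (map (λ i → f i k) is)

-- Σ_{i ≥ 1} f i = s, in the sense of coefficientwise eventually constant
-- partial sums f 1 + ⋯ + f n.
∑≥1_↦_ : (ℕ → Series) → Series → Set
∑≥1 f ↦ s = ∀ k → ∃[ M ] ∀ n → M ≤ n → sumOver (map suc (upTo n)) f k ≡ s k

module Submission where

-- Both families are parametrised by the same shapes, and the terms of the
-- generating function enumerate the shapes by weight.  A shape is either full N,
-- of weight C(N + 1, 2), or notched l p q with P = p + 1 and Q = q + 1, of weight
-- C(l + P + Q + 1, 2) - P Q.  The latter is the exponent of the double sum for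
-- i = l + P and j = l + Q (notchWeight-unique).
--
-- Permutations.  A permutation is determined by the set of its ascents, that is,
-- the pairs of positions i < j whose values increase (determined).  Let a
-- permutation avoid 123 and 231.  If it has no ascents it is decreasing.
-- Otherwise let c be the first position that starts an ascent, and e the first
-- position that ends an ascent from c.  Avoidance forces the ascents to be exactly
-- the pairs with c <= i < e <= j (ascents-block).  These are the ascents of the
-- skew sum of a decreasing permutation of length c with the sum of two decreasing
-- permutations.  It is decomposable if c = 0, and indecomposable otherwise; the
-- latter case is the shape with c = l + 1 and e = c + P (classification).  Ascents
-- form a block of P Q pairs, so the number of inversions is the weight.
--
-- Fountains.  The missing coins of a fountain are closed upwards within the
-- triangle, so a non-empty rectangle of missing coins consists of the first P
-- up-right and the last Q up-left diagonals; it avoids the bottom row exactly when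
-- P + Q does not exceed the width N, and then N = l + P + Q for some l
-- (rectangle⇒shape).  In terms of pairs of diagonals the missing coins again form
-- a block of P Q pairs (kept-pairs counts the pairs outside a block for both
-- families), so the number of coins is the weight.
--
-- Hence for each k the shapes of weight k are in bijection with either family, and
-- their number is the coefficient of x^k.

open import Defs
open import Data.Empty using (⊥; ⊥-elim)
open import Data.Fin.Base as Fin
  using (Fin; zero; suc; toℕ; fromℕ<; inject₁; opposite; splitAt; join; _↑ˡ_; _↑ʳ_)
open import Data.Fin.Patterns using (0F; 1F; 2F)
open import Data.Fin.Permutation as Perm
  using (Permutation′; _∘ₚ_; _⟨$⟩ʳ_; _⟨$⟩ˡ_; inverseˡ; inverseʳ)
import Data.Fin.Properties as Fin
open import Data.List.Base
  using (List; _∷_; []; _++_; length; lookup; map; upTo; filter; allFin; cartesianProduct)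
open import Data.List.Membership.Propositional using (_∈_)
open import Data.List.Membership.Propositional.Properties
  using (∈-++⁺ˡ; ∈-++⁺ʳ; ∈-++⁻; ∈-map⁺; ∈-map⁻; ∈-upTo⁺; ∈-upTo⁻; ∈-lookup; ∈-allFin;
         ∈-cartesianProduct⁺; ∈-cartesianProduct⁻; ∈-filter⁺; ∈-filter⁻)
open import Data.List.Membership.Propositional.Properties.WithK using (unique∧set⇒bag)
open import Data.List.Properties using (length-++; length-map; length-upTo; upTo-∷ʳ; map-++)
open import Data.List.Relation.Binary.BagAndSetEquality using (∼bag⇒↭)
open import Data.List.Relation.Binary.Permutation.Propositional.Properties using (↭-length)
import Data.List.Relation.Unary.All as All
import Data.List.Relation.Unary.All.Properties as All
open import Data.List.Relation.Unary.AllPairs using ([]; _∷_)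
open import Data.List.Relation.Unary.Any using (here; there; index)
open import Data.List.Relation.Unary.Any.Properties using (lookup-index)
open import Data.List.Relation.Unary.Unique.Propositional using (Unique)
import Data.List.Relation.Unary.Unique.Propositional.Properties as Unique
open import Data.Nat.Base
open import Data.Nat.Combinatorics using (_C_; nC1≡n; nCk+nC[k+1]≡[n+1]C[k+1])
open import Data.Nat.ListAction using (sum)
open import Data.Nat.ListAction.Properties using (sum-++)
open import Data.Nat.Properties
open import Data.Nat.Tactic.RingSolver using (solve-∀)
open import Data.Product.Base using (Σ-syntax; ∃; ∃-syntax; _×_; _,_; proj₁; proj₂)
open import Data.Sum.Base using (_⊎_; inj₁; inj₂; [_,_]′)
open import Data.Unit.Base using (⊤; tt)
open import Function.Base using (_∘_; id)
open import Function.Bundles using (_⇔_; mk⇔; module Equivalence)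
open import Function.Properties.Bijection using (Bijection⇒Inverse)
open import Level using (0ℓ)
open import Relation.Binary.Bundles using (Setoid)
open import Relation.Binary.Definitions using (tri<; tri≈; tri>)
open import Relation.Binary.PropositionalEquality
  using (_≡_; _≗_; refl; sym; trans; cong; cong₂; subst; subst₂; module ≡-Reasoning)
open import Relation.Nullary using (yes; no; ¬_)
open import Relation.Nullary.Decidable using (_×-dec_; ¬?; decidable-stable)
open import Relation.Unary using (Pred; Decidable; _≐_)
open import Relation.Unary.Properties using (≐-sym)

open Equivalence using (to; from)
open Fountain using (Coins; coin?; coinCount; Missing; inside; bottom; supported)

private variable
  A B : Set
  m n : ℕ

-- Counting finite sets

-- The predicate P holds of exactly n elements: they are listed without
-- repetition.
record Enumerated (P : Pred A 0ℓ) (n : ℕ) : Set where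
  constructor enumerated
  field
    elements : List A
    unique   : Unique elements
    sound    : ∀ {x} → x ∈ elements → P x
    complete : ∀ {x} → P x → x ∈ elements
    size≡    : length elements ≡ n

open Enumerated

module _ {P Q : Pred A 0ℓ} where

  -- Two enumerations of the same set are permutations of each other.
  size-unique : P ≐ Q → Enumerated P m → Enumerated Q n → m ≡ n
  size-unique (P⊆Q , Q⊆P) e f = begin
    _                     ≡⟨ size≡ e ⟨
    length (elements e)   ≡⟨ ↭-length (∼bag⇒↭ (unique∧set⇒bag (unique e) (unique f)
                               (mk⇔ (complete f ∘ P⊆Q ∘ sound e)
                                    (complete e ∘ Q⊆P ∘ sound f)))) ⟩
    length (elements f)   ≡⟨ size≡ f ⟩
    _                     ∎
    where open ≡-Reasoning

  union : {R : Pred A 0ℓ} → Enumerated P m → Enumerated Q n →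
          (∀ {x} → P x → ¬ Q x) → R ≐ (λ x → P x ⊎ Q x) →
          Enumerated R (m + n)
  union e f disjoint (to , from) = enumerated
    (elements e ++ elements f)
    (Unique.++⁺ (unique e) (unique f)
      (λ (x∈e , x∈f) → disjoint (sound e x∈e) (sound f x∈f)))
    (from ∘ [ inj₁ ∘ sound e , inj₂ ∘ sound f ]′ ∘ ∈-++⁻ (elements e))
    ([ ∈-++⁺ˡ ∘ complete e , ∈-++⁺ʳ (elements e) ∘ complete f ]′ ∘ to)
    (trans (length-++ (elements e)) (cong₂ _+_ (size≡ e) (size≡ f)))

unique-map : (f : A → B) {xs : List A} → Unique xs →
             (∀ {x y} → x ∈ xs → y ∈ xs → f x ≡ f y → x ≡ y) →
             Unique (map f xs)
unique-map f []         inj = []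
unique-map f (x∉xs ∷ u) inj =
  All.map⁺ (All.tabulate (λ y∈ eq → All.lookup x∉xs y∈ (inj (here refl) (there y∈) eq)))
  ∷ unique-map f u (λ x∈ y∈ → inj (there x∈) (there y∈))

-- Injectivity is only required on P, so f may identify elements outside P.
image : {P : Pred A 0ℓ} {Q : Pred B 0ℓ} (f : A → B) →
        (∀ {x} → P x → Q (f x)) →
        (∀ {x y} → P x → P y → f x ≡ f y → x ≡ y) →
        (∀ {y} → Q y → Σ[ x ∈ A ] P x × f x ≡ y) →
        Enumerated P n → Enumerated Q n
image {Q = Q} f fwd inj onto e = enumerated
  (map f (elements e))
  (unique-map f (unique e) (λ x∈ y∈ → inj (sound e x∈) (sound e y∈)))
  (λ y∈ → let (x , x∈ , y≡) = ∈-map⁻ f y∈ in subst Q (sym y≡) (fwd (sound e x∈)))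
  (λ Qy → let (x , Px , eq) = onto Qy in subst (_∈ _) eq (∈-map⁺ f (complete e Px)))
  (trans (length-map f (elements e)) (size≡ e))

length-cartesianProduct : (xs : List A) (ys : List B) →
  length (cartesianProduct xs ys) ≡ length xs * length ys
length-cartesianProduct []       ys = refl
length-cartesianProduct (x ∷ xs) ys =
  trans (length-++ (map (x ,_) ys))
        (cong₂ _+_ (length-map (x ,_) ys) (length-cartesianProduct xs ys))

product : {P : Pred A 0ℓ} {Q : Pred B 0ℓ} → Enumerated P m → Enumerated Q n →
          Enumerated {A = A × B} (λ (x , y) → P x × Q y) (m * n)
product e f = enumerated
  (cartesianProduct (elements e) (elements f))
  (Unique.cartesianProduct⁺ (unique e) (unique f))
  (λ xy∈ → let (x∈ , y∈) = ∈-cartesianProduct⁻ (elements e) (elements f) xy∈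
           in sound e x∈ , sound f y∈)
  (λ (Px , Qy) → ∈-cartesianProduct⁺ (complete e Px) (complete f Qy))
  (trans (length-cartesianProduct (elements e) (elements f))
         (cong₂ _*_ (size≡ e) (size≡ f)))

filtered : {P : Pred A 0ℓ} (P? : Decidable P) (xs : List A) → Unique xs →
           (∀ {x} → P x → x ∈ xs) → Enumerated P (length (filter P? xs))
filtered P? xs u all = enumerated
  (filter P? xs) (Unique.filter⁺ P? u) (proj₂ ∘ ∈-filter⁻ P? {xs = xs})
  (λ Px → ∈-filter⁺ P? (all Px) Px) refl

-- The disjoint union of a family of sets has as size the sum of their sizes.
indexed : {P : A → Pred B 0ℓ} {f : A → ℕ} {is : List A} → Unique is →
          (∀ {i} → i ∈ is → Enumerated (P i) (f i)) →
          Enumerated {A = A × B} (λ (i , x) → i ∈ is × P i x) (sum (map f is))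
indexed []        e = enumerated [] [] (λ ()) (λ ()) refl
indexed {P = P} {is = i ∷ is} (i∉ ∷ u) e =
  union
    (image {B = _ × _} {Q = λ (j , x) → j ≡ i × P i x} (i ,_)
           (λ Px → refl , Px) (λ { _ _ refl → refl })
           (λ { (refl , Px) → _ , Px , refl }) (e (here refl)))
    (indexed {P = P} u (e ∘ there))
    (λ { {_ , _} (refl , _) (i∈ , _) → All.lookup i∉ i∈ refl })
    ( (λ { {_ , _} (here refl , Px) → inj₁ (refl , Px)
          ; {_ , _} (there j∈ , Px) → inj₂ (j∈ , Px) })
    , (λ { {_ , _} (inj₁ (refl , Px)) → here refl , Px
          ; {_ , _} (inj₂ (j∈ , Px)) → there j∈ , Px }))

interval : ∀ a u → Enumerated (λ i → a ≤ i × i < a + u) u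
interval a u = enumerated
  (map (a +_) (upTo u))
  (Unique.map⁺ (+-cancelˡ-≡ a _ _) (Unique.upTo⁺ u))
  (λ x∈ → let (j , j∈ , eq) = ∈-map⁻ (a +_) x∈ in
          subst (λ x → a ≤ x × x < a + u) (sym eq)
                (m≤m+n a j , +-monoʳ-< a (∈-upTo⁻ j∈)))
  (λ {x} (a≤x , x<a+u) →
     subst (_∈ _) (m+[n∸m]≡n a≤x)
       (∈-map⁺ (a +_) (∈-upTo⁺ (+-cancelˡ-< a _ _
         (subst (_< a + u) (sym (m+[n∸m]≡n a≤x)) x<a+u)))))
  (trans (length-map (a +_) (upTo u)) (length-upTo u))

-- The coefficient of x^k in the monomial of degree w is the size of the truth
-- value w ≡ k, as a subset of the one-element type.
monomial : ∀ w k → Enumerated (λ (_ : ⊤) → w ≡ k) ((x^ w) k)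
monomial w k with w ≟ k
... | yes w≡k = enumerated (tt ∷ []) (All.[] ∷ []) (λ _ → w≡k) (λ _ → here refl) refl
... | no  w≢k = enumerated [] [] (λ ()) (⊥-elim ∘ w≢k) refl

lookup-injective : {xs : List A} → Unique xs → ∀ {i j} → lookup xs i ≡ lookup xs j → i ≡ j
lookup-injective (x∉ ∷ u) {Fin.zero}  {Fin.zero}  eq = refl
lookup-injective (x∉ ∷ u) {Fin.zero}  {Fin.suc j} eq = ⊥-elim (All.lookup x∉ (∈-lookup j) eq)
lookup-injective (x∉ ∷ u) {Fin.suc i} {Fin.zero}  eq = ⊥-elim (All.lookup x∉ (∈-lookup i) (sym eq))
lookup-injective (x∉ ∷ u) {Fin.suc i} {Fin.suc j} eq = cong Fin.suc (lookup-injective u eq)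

module _ {s ℓ} (S : Setoid s ℓ) {P : Pred A 0ℓ} where
  open Setoid S using (Carrier; _≈_) renaming (reflexive to ≈-reflexive)

  -- A map f on P that is injective and onto modulo the equality of S carries
  -- the size of P to S.  In the last hypothesis f is allowed to depend on the
  -- proof of P x.
  cardinality : (f : ∀ {x} → P x → Carrier) →
                (∀ {x y} (p : P x) (q : P y) → f p ≈ f q → x ≡ y) →
                (∀ y → Σ[ x ∈ A ] P x × (∀ (p : P x) → f p ≈ y)) →
                Enumerated P n → HasCardinality S n
  cardinality f inj onto (enumerated xs u sound complete refl) =
    Bijection⇒Inverse (record
      { to        = element
      ; cong      = ≈-reflexive ∘ cong element
      ; bijective = (λ {i} {j} eq → lookup-injective u
                      (inj (sound (∈-lookup i)) (sound (∈-lookup j)) eq))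
                  , λ y → let (x , Px , f≈y) = onto y
                              x∈ = complete Px
                          in index x∈ , λ { refl → subst (λ z → (p : P z) → f p ≈ y)
                                              (lookup-index x∈) f≈y _ }
      })
    where
    element : Fin (length xs) → Carrier
    element i = f (sound (∈-lookup i))

-- Pairs of naturals outside a rectangular block

-- The pairs i < j < n.
Pair : ℕ → Pred (ℕ × ℕ) 0ℓ
Pair n (i , j) = i < j × j < n

suc-C2 : ∀ n → suc n C 2 ≡ n + n C 2
suc-C2 n = begin
  suc n C 2      ≡⟨ nCk+nC[k+1]≡[n+1]C[k+1] n 1 ⟨
  n C 1 + n C 2  ≡⟨ cong (_+ n C 2) (nC1≡n n) ⟩
  n + n C 2      ∎
  where open ≡-Reasoning

pairs : ∀ n → Enumerated (Pair n) (n C 2)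
pairs zero    = enumerated [] [] (λ ()) (λ ()) refl
pairs (suc n) = subst (Enumerated _) (sym (suc-C2 n)) (union
  (image {P = λ i → 0 ≤ i × i < n} {Q = λ (i , j) → j ≡ n × i < n} (_, n)
         (λ (_ , i<n) → refl , i<n) (λ { _ _ refl → refl })
         (λ { (refl , i<n) → _ , (z≤n , i<n) , refl }) (interval 0 n))
  (pairs n)
  (λ { {_ , _} (refl , _) (_ , n<n) → <-irrefl refl n<n })
  ( (λ { {i , j} (i<j , s≤s j≤n) → [ (λ j<n → inj₂ (i<j , j<n)) ,
                                      (λ { refl → inj₁ (refl , i<j) }) ]′ (m≤n⇒m<n∨m≡n j≤n) })
  , (λ { {_ , _} (inj₁ (refl , i<n)) → i<n , ≤-refl
        ; {_ , _} (inj₂ (i<j , j<n)) → i<j , m<n⇒m<1+n j<n })))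

-- The pairs (i , j) with i in the interval of length u that starts at a, and j
-- at least b.
Block : (a u b : ℕ) → Pred (ℕ × ℕ) 0ℓ
Block a u b (i , j) = (a ≤ i × i < a + u) × b ≤ j

block? : ∀ a u b → Decidable (Block a u b)
block? a u b (i , j) = ((a ≤? i) ×-dec (i <? a + u)) ×-dec (b ≤? j)

-- When the block lies above the diagonal it is a product of intervals of
-- lengths u and v, hence the pairs outside of it are u * v fewer than all pairs.
kept-pairs : ∀ a u b v → a + u ≤ b →
  Enumerated (λ x → Pair (b + v) x × ¬ Block a u b x) m →
  m + u * v ≡ (b + v) C 2
kept-pairs a u b v a+u≤b kept = size-unique (id , id)
  (union kept (product (interval a u) (interval b v))
    (λ (_ , ¬block) (a≤i<a+u , b≤j , _) → ¬block (a≤i<a+u , b≤j))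
    ( split
    , [ proj₁ , (λ ((_ , i<a+u) , (b≤j , j<n)) → <-≤-trans i<a+u (≤-trans a+u≤b b≤j) , j<n) ]′))
  (pairs (b + v))
  where
  split : ∀ {x} → Pair (b + v) x → _
  split {x} pair@(_ , j<n) with block? a u b x
  ... | yes (a≤i<a+u , b≤j) = inj₂ (a≤i<a+u , b≤j , j<n)
  ... | no  ¬block          = inj₁ (pair , ¬block)

-- Triangular numbers and shapes

triangle : ℕ → ℕ
triangle n = (n + 1) C 2

triangle≡ : ∀ n → suc n C 2 ≡ triangle n
triangle≡ n = cong (_C 2) (+-comm 1 n)

triangle-suc : ∀ n → triangle (suc n) ≡ suc n + triangle n
triangle-suc n = trans (suc-C2 (n + 1)) (cong (_+ triangle n) (+-comm n 1))

triangle-+ : ∀ a b → triangle (a + b) ≡ triangle a + (triangle b + a * b)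
triangle-+ zero    b = sym (+-identityʳ (triangle b))
triangle-+ (suc a) b = begin
  triangle (suc a + b)                                ≡⟨ triangle-suc (a + b) ⟩
  suc (a + b) + triangle (a + b)                      ≡⟨ cong (suc (a + b) +_) (triangle-+ a b) ⟩
  suc (a + b) + (triangle a + (triangle b + a * b))   ≡⟨ rearrange a b (triangle a) (triangle b) ⟩
  suc a + triangle a + (triangle b + suc a * b)
    ≡⟨ cong (_+ (triangle b + suc a * b)) (triangle-suc a) ⟨
  triangle (suc a) + (triangle b + suc a * b)         ∎
  where
  open ≡-Reasoning
  rearrange : ∀ a b s t → suc (a + b) + (s + (t + a * b)) ≡ suc a + s + (t + suc a * b)
  rearrange = solve-∀

n≤triangle : ∀ n → n ≤ triangle n
n≤triangle zero    = z≤n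
n≤triangle (suc n) = subst (suc n ≤_) (sym (triangle-suc n)) (m≤m+n (suc n) _)

triangle-mono : ∀ {m n} → m ≤ n → triangle m ≤ triangle n
triangle-mono {m} m≤n =
  subst (λ n → triangle m ≤ triangle n) (m+[n∸m]≡n m≤n)
        (subst (triangle m ≤_) (sym (triangle-+ m _)) (m≤m+n _ _))

-- The exponent of the double sum.
notchWeight : (i j l : ℕ) → ℕ
notchWeight i j l = (triangle i + triangle j) ∸ triangle l

-- The exponent in the form in which it arises from counting: with i = l + P and
-- j = l + Q it is the number of pairs below l + 1 + P + Q, less P * Q.
notchWeight-unique : ∀ l P Q m → m + P * Q ≡ ((suc l + P) + Q) C 2 →
                     m ≡ notchWeight (l + P) (l + Q) l
notchWeight-unique l P Q m eq = begin
  m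
    ≡⟨ +-cancelʳ-≡ (P * Q) m rest (trans eq total) ⟩
  rest
    ≡⟨ m+n∸m≡n (triangle l) rest ⟨
  triangle l + rest ∸ triangle l
    ≡⟨ cong (_∸ triangle l) (regroup l P Q (triangle l) (triangle P) (triangle Q)) ⟩
  (triangle l + (triangle P + l * P)) + (triangle l + (triangle Q + l * Q)) ∸ triangle l
    ≡⟨ cong (_∸ triangle l) (cong₂ _+_ (triangle-+ l P) (triangle-+ l Q)) ⟨
  notchWeight (l + P) (l + Q) l
    ∎
  where
  open ≡-Reasoning
  rest : ℕ
  rest = triangle l + (triangle P + triangle Q + (l * P + l * Q))
  regroup : ∀ l P Q s t u → s + (s + (t + u + (l * P + l * Q))) ≡
            (s + (t + l * P)) + (s + (u + l * Q))
  regroup = solve-∀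
  collect : ∀ l P Q s t u → s + (t + l * P) + (u + (l + P) * Q) ≡
            s + (t + u + (l * P + l * Q)) + P * Q
  collect = solve-∀
  total : ((suc l + P) + Q) C 2 ≡ rest + P * Q
  total = begin
    suc ((l + P) + Q) C 2                            ≡⟨ triangle≡ ((l + P) + Q) ⟩
    triangle ((l + P) + Q)                           ≡⟨ triangle-+ (l + P) Q ⟩
    triangle (l + P) + (triangle Q + (l + P) * Q)
      ≡⟨ cong (_+ (triangle Q + (l + P) * Q)) (triangle-+ l P) ⟩
    (triangle l + (triangle P + l * P)) + (triangle Q + (l + P) * Q)
      ≡⟨ collect l P Q (triangle l) (triangle P) (triangle Q) ⟩
    rest + P * Q                                     ∎

-- The common parameters of the permutations and of the fountains.
--
-- full N stands for the decreasing permutation of length N + 1 and for the full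
-- triangular fountain of width N.
--
-- notched l p q stands for the permutation formed by a decreasing run of l + 1
-- maximal values followed by the sum of two decreasing permutations of lengths
-- p + 1 and q + 1, and for the fountain in which the missing coins are those on
-- the first p + 1 up-right and the last q + 1 up-left diagonals.
data Shape : Set where
  full    : (N : ℕ) → Shape
  notched : (l p q : ℕ) → Shape

-- The number of inversions, and the number of coins.
weight : Shape → ℕ
weight (full N)        = suc N C 2
weight (notched l p q) = notchWeight (l + suc p) (l + suc q) l

-- The width of the fountain, one less than the length of the permutation.
width : Shape → ℕ
width (full N)        = N
width (notched l p q) = (l + suc p) + suc q

-- The smallest missing up-left diagonal is one of the diagonals.
inner≤width : ∀ l p q → suc l + suc p ≤ width (notched l p q)
inner≤width l p q =
  subst (suc l + suc p ≤_) (sym (+-suc (l + suc p) q)) (s≤s (m≤m+n (l + suc p) q))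

-- Ascents of permutations

both-false : {A B : Set} → ¬ A → ¬ B → A ⇔ B
both-false ¬a ¬b = mk⇔ (⊥-elim ∘ ¬a) (⊥-elim ∘ ¬b)

injective : (π : Permutation′ n) {a b : Fin n} → π ⟨$⟩ʳ a ≡ π ⟨$⟩ʳ b → a ≡ b
injective π eq = trans (sym (inverseˡ π)) (trans (cong (π ⟨$⟩ˡ_) eq) (inverseˡ π))

-- R describes the pairs of positions, in increasing order, whose values
-- increase.  What R says of other pairs of naturals is irrelevant.
HasAscents : Permutation → Pred (ℕ × ℕ) 0ℓ → Set
HasAscents (n , π) R = ∀ {a b : Fin n} → a Fin.< b →
  (π ⟨$⟩ʳ a Fin.< π ⟨$⟩ʳ b) ⇔ R (toℕ a , toℕ b)

Decreasing : Permutation → Set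
Decreasing (n , π) = ∀ {a b : Fin n} → a Fin.< b → π ⟨$⟩ʳ b Fin.< π ⟨$⟩ʳ a

¬ascent⇒descent : (π : Permutation′ n) {a b : Fin n} → a Fin.< b →
  ¬ (π ⟨$⟩ʳ a Fin.< π ⟨$⟩ʳ b) → π ⟨$⟩ʳ b Fin.< π ⟨$⟩ʳ a
¬ascent⇒descent π {a} {b} a<b ¬asc with Fin.<-cmp (π ⟨$⟩ʳ a) (π ⟨$⟩ʳ b)
... | tri< asc _ _ = ⊥-elim (¬asc asc)
... | tri≈ _ eq _  = ⊥-elim (Fin.<-irrefl (injective π eq) a<b)
... | tri> _ _ des = des

≋-HasAscents : ∀ {π σ R} → π ≋ σ → HasAscents π R → HasAscents σ R
≋-HasAscents (pointwise π≈σ) asc {a} {b} a<b =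
  mk⇔ (to (asc a<b) ∘ subst₂ Fin._<_ (sym (π≈σ a)) (sym (π≈σ b)))
      (subst₂ Fin._<_ (π≈σ a) (π≈σ b) ∘ from (asc a<b))

HasAscents-unique : ∀ π {R S} → HasAscents π R → HasAscents π S →
                    ∀ {i j} → i < j → j < size π → R (i , j) → S (i , j)
HasAscents-unique π {R} {S} ascR ascS {i} {j} i<j j<n Rij =
  subst S eq (to (ascS a<b) (from (ascR a<b) (subst R (sym eq) Rij)))
  where
  i<n = <-trans i<j j<n
  eq : (toℕ (fromℕ< i<n) , toℕ (fromℕ< j<n)) ≡ (i , j)
  eq = cong₂ _,_ (Fin.toℕ-fromℕ< i<n) (Fin.toℕ-fromℕ< j<n)
  a<b : fromℕ< i<n Fin.< fromℕ< j<n
  a<b = subst₂ _<_ (sym (Fin.toℕ-fromℕ< i<n)) (sym (Fin.toℕ-fromℕ< j<n)) i<j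

increasing⇒expansive : (f : Fin m → Fin n) →
  (∀ {a b} → a Fin.< b → f a Fin.< f b) → ∀ a → toℕ a ≤ toℕ (f a)
increasing⇒expansive f mono zero    = z≤n
increasing⇒expansive f mono (suc a) = ≤-<-trans
  (increasing⇒expansive (f ∘ inject₁)
    (λ {x} {y} x<y → mono (subst₂ _<_ (sym (Fin.toℕ-inject₁ x)) (sym (Fin.toℕ-inject₁ y)) x<y)) a)
  (mono (s≤s (≤-reflexive (Fin.toℕ-inject₁ a))))

-- Trichotomy transports the order of the values from π to σ also for pairs of
-- positions that are not in increasing order.
order-determined : ∀ R {π σ : Permutation′ n} → HasAscents (n , π) R → HasAscents (n , σ) R →
  ∀ {a b} → π ⟨$⟩ʳ a Fin.< π ⟨$⟩ʳ b → σ ⟨$⟩ʳ a Fin.< σ ⟨$⟩ʳ b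
order-determined R {π} {σ} ascπ ascσ {a} {b} πa<πb with Fin.<-cmp a b
... | tri< a<b _ _  = from (ascσ a<b) (to (ascπ a<b) πa<πb)
... | tri≈ _ refl _ = ⊥-elim (Fin.<-irrefl refl πa<πb)
... | tri> _ _ b<a  = ¬ascent⇒descent σ b<a
  λ σb<σa → Fin.<-asym πa<πb (from (ascπ b<a) (to (ascσ b<a) σb<σa))

-- The map that sends a value of π to the value of σ at the same position is
-- increasing, hence expansive.
determined-≤ : ∀ R {π σ : Permutation′ n} → HasAscents (n , π) R → HasAscents (n , σ) R →
  ∀ a → toℕ (π ⟨$⟩ʳ a) ≤ toℕ (σ ⟨$⟩ʳ a)
determined-≤ R {π} {σ} ascπ ascσ a =
  subst (λ x → toℕ (π ⟨$⟩ʳ a) ≤ toℕ (σ ⟨$⟩ʳ x)) (inverseˡ π)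
    (increasing⇒expansive (λ x → σ ⟨$⟩ʳ (π ⟨$⟩ˡ x))
      (λ x<y → order-determined R {π} {σ} ascπ ascσ
                 (subst₂ Fin._<_ (sym (inverseʳ π)) (sym (inverseʳ π)) x<y))
      (π ⟨$⟩ʳ a))

-- A permutation is determined by its length and its ascents.
determined : ∀ {π σ} R → size π ≡ size σ → HasAscents π R → HasAscents σ R → π ≋ σ
determined {_ , π} {_ , σ} R refl ascπ ascσ = pointwise λ a →
  Fin.toℕ-injective (≤-antisym (determined-≤ R {π} {σ} ascπ ascσ a)
                               (determined-≤ R {σ} {π} ascσ ascπ a))

-- Sums and skew sums

-- The permutation n … 2 1.
decreasing : ℕ → Permutation
decreasing n = n , Perm.reverse

-- Reverses the order of the values.
complement : Permutation → Permutation
complement (n , π) = n , π ∘ₚ Perm.reverse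

infixl 6 _⊖_

-- The skew sum: ρ on the larger values, followed by τ on the smaller ones.
-- Defined by complementation, so that no lengths m + n and n + m have to be
-- identified.
_⊖_ : Permutation → Permutation → Permutation
ρ ⊖ τ = complement (complement ρ ⊕ complement τ)

opposite-anti : {a b : Fin n} → a Fin.< b → opposite b Fin.< opposite a
opposite-anti {n} {a} {b} a<b =
  subst₂ _<_ (sym (Fin.opposite-prop b)) (sym (Fin.opposite-prop a))
    (∸-monoʳ-< (s≤s a<b) (Fin.toℕ<n b))

opposite-anti⁻¹ : {a b : Fin n} → opposite a Fin.< opposite b → b Fin.< a
opposite-anti⁻¹ {a = a} {b} lt =
  subst₂ Fin._<_ (Fin.opposite-involutive b) (Fin.opposite-involutive a) (opposite-anti lt)

-- Every position of a sum belongs to exactly one summand.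
data Split (m n : ℕ) : Fin (m + n) → Set where
  left  : (a : Fin m) → Split m n (a ↑ˡ n)
  right : (b : Fin n) → Split m n (m ↑ʳ b)

split : ∀ m n (x : Fin (m + n)) → Split m n x
split m n x = subst (Split m n) (Fin.join-splitAt m n x) (view (splitAt m x))
  where
  view : (s : Fin m ⊎ Fin n) → Split m n (join m n s)
  view (inj₁ a) = left a
  view (inj₂ b) = right b

↑ˡ-mono : ∀ n {a b : Fin m} → a Fin.< b → a ↑ˡ n Fin.< b ↑ˡ n
↑ˡ-mono n {a} {b} = subst₂ _<_ (sym (Fin.toℕ-↑ˡ a n)) (sym (Fin.toℕ-↑ˡ b n))

↑ˡ-mono⁻¹ : ∀ n {a b : Fin m} → a ↑ˡ n Fin.< b ↑ˡ n → a Fin.< b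
↑ˡ-mono⁻¹ n {a} {b} = subst₂ _<_ (Fin.toℕ-↑ˡ a n) (Fin.toℕ-↑ˡ b n)

↑ʳ-mono : ∀ m {a b : Fin n} → a Fin.< b → m ↑ʳ a Fin.< m ↑ʳ b
↑ʳ-mono m {a} {b} a<b =
  subst₂ _<_ (sym (Fin.toℕ-↑ʳ m a)) (sym (Fin.toℕ-↑ʳ m b)) (+-monoʳ-< m a<b)

↑ʳ-mono⁻¹ : ∀ m {a b : Fin n} → m ↑ʳ a Fin.< m ↑ʳ b → a Fin.< b
↑ʳ-mono⁻¹ m {a} {b} lt =
  +-cancelˡ-< m _ _ (subst₂ _<_ (Fin.toℕ-↑ʳ m a) (Fin.toℕ-↑ʳ m b) lt)

toℕ-↑ˡ< : ∀ n (a : Fin m) → toℕ (a ↑ˡ n) < m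
toℕ-↑ˡ< n a = subst (_< _) (sym (Fin.toℕ-↑ˡ a n)) (Fin.toℕ<n a)

≤toℕ-↑ʳ : ∀ m (b : Fin n) → m ≤ toℕ (m ↑ʳ b)
≤toℕ-↑ʳ m b = subst (m ≤_) (sym (Fin.toℕ-↑ʳ m b)) (m≤m+n m _)

↑ˡ<↑ʳ : (a : Fin m) (b : Fin n) → a ↑ˡ n Fin.< m ↑ʳ b
↑ˡ<↑ʳ {m} {n} a b = <-≤-trans (toℕ-↑ˡ< n a) (≤toℕ-↑ʳ m b)

module _ {m n} (ρ : Permutation′ m) (τ : Permutation′ n) where

  ⊕-left : ∀ a → proj₂ ((m , ρ) ⊕ (n , τ)) ⟨$⟩ʳ (a ↑ˡ n) ≡ (ρ ⟨$⟩ʳ a) ↑ˡ n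
  ⊕-left a rewrite Fin.splitAt-↑ˡ m a n = refl

  ⊕-right : ∀ b → proj₂ ((m , ρ) ⊕ (n , τ)) ⟨$⟩ʳ (m ↑ʳ b) ≡ m ↑ʳ (τ ⟨$⟩ʳ b)
  ⊕-right b rewrite Fin.splitAt-↑ʳ m n b = refl

⊕-cross : ∀ ρ τ (a : Fin (size ρ)) (b : Fin (size τ)) →
  proj₂ (ρ ⊕ τ) ⟨$⟩ʳ (a ↑ˡ size τ) Fin.< proj₂ (ρ ⊕ τ) ⟨$⟩ʳ (size ρ ↑ʳ b)
⊕-cross (m , ρ) (n , τ) a b
  rewrite ⊕-left ρ τ a | ⊕-right ρ τ b = ↑ˡ<↑ʳ (ρ ⟨$⟩ʳ a) (τ ⟨$⟩ʳ b)

decreasing-Decreasing : ∀ n → Decreasing (decreasing n)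
decreasing-Decreasing n = opposite-anti

⊕-ascents : ∀ ρ τ → Decreasing ρ → Decreasing τ →
            HasAscents (ρ ⊕ τ) (Block 0 (size ρ) (size ρ))
⊕-ascents (m , ρ) (n , τ) dρ dτ {x} {y} x<y with split m n x | split m n y
... | left a | left b rewrite ⊕-left ρ τ a | ⊕-left ρ τ b = both-false
  (λ asc → Fin.<-asym (↑ˡ-mono⁻¹ n asc) (dρ (↑ˡ-mono⁻¹ n x<y)))
  (λ (_ , m≤b) → <⇒≱ (toℕ-↑ˡ< n b) m≤b)
... | left a | right b = mk⇔
  (λ _ → (z≤n , toℕ-↑ˡ< n a) , ≤toℕ-↑ʳ m b)
  (λ _ → ⊕-cross (m , ρ) (n , τ) a b)
... | right a | left b = ⊥-elim (Fin.<-asym x<y (↑ˡ<↑ʳ b a))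
... | right a | right b rewrite ⊕-right ρ τ a | ⊕-right ρ τ b = both-false
  (λ asc → Fin.<-asym (↑ʳ-mono⁻¹ m asc) (dτ (↑ʳ-mono⁻¹ m x<y)))
  (λ ((_ , a<m) , _) → <⇒≱ a<m (≤toℕ-↑ʳ m a))

⊖-ascents : ∀ ρ τ {u b} → Decreasing ρ → HasAscents τ (Block 0 u b) →
            HasAscents (ρ ⊖ τ) (Block (size ρ) u (size ρ + b))
⊖-ascents (m , ρ) (n , τ) {u} {b} dρ ascτ {x} {y} x<y with split m n x | split m n y
... | left i | left j
  rewrite ⊕-left (ρ ∘ₚ Perm.reverse) (τ ∘ₚ Perm.reverse) i
        | ⊕-left (ρ ∘ₚ Perm.reverse) (τ ∘ₚ Perm.reverse) j = both-false
  (λ asc → Fin.<-asym (dρ (↑ˡ-mono⁻¹ n x<y))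
                      (opposite-anti⁻¹ (↑ˡ-mono⁻¹ n (opposite-anti⁻¹ asc))))
  (λ ((m≤i , _) , _) → <⇒≱ (toℕ-↑ˡ< n i) m≤i)
... | left i | right j = both-false
  (λ asc → Fin.<-asym (opposite-anti⁻¹ asc)
                      (⊕-cross (m , ρ ∘ₚ Perm.reverse) (n , τ ∘ₚ Perm.reverse) i j))
  (λ ((m≤i , _) , _) → <⇒≱ (toℕ-↑ˡ< n i) m≤i)
... | right i | left j = ⊥-elim (Fin.<-asym x<y (↑ˡ<↑ʳ j i))
... | right i | right j
  rewrite ⊕-right (ρ ∘ₚ Perm.reverse) (τ ∘ₚ Perm.reverse) i
        | ⊕-right (ρ ∘ₚ Perm.reverse) (τ ∘ₚ Perm.reverse) j
        | Fin.toℕ-↑ʳ m i | Fin.toℕ-↑ʳ m j = mk⇔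
  (λ asc → let ((_ , i<u) , b≤j) = to (ascτ i<j)
                 (opposite-anti⁻¹ (↑ʳ-mono⁻¹ m (opposite-anti⁻¹ asc)))
           in (m≤m+n m _ , +-monoʳ-< m i<u) , +-monoʳ-≤ m b≤j)
  (λ ((_ , i<u) , b≤j) → opposite-anti (↑ʳ-mono m (opposite-anti
     (from (ascτ i<j) ((z≤n , +-cancelˡ-< m _ _ i<u) , +-cancelˡ-≤ m _ _ b≤j)))))
  where
  i<j = +-cancelˡ-< m (toℕ i) (toℕ j) x<y

-- The permutations of each shape

-- The pairs of positions at which a permutation of the given shape ascends: the
-- first position is in the first run of the sum, the second one in the second.
Rises : Shape → Pred (ℕ × ℕ) 0ℓ
Rises (full N)        _ = ⊥
Rises (notched l p q) x = Block (suc l) (suc p) (suc l + suc p) x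

-- The length and the ascents of π are those prescribed by s.
record PermHasShape (π : Permutation) (s : Shape) : Set where
  constructor _,_
  field
    size≡   : size π ≡ suc (width s)
    ascents : HasAscents π (Rises s)

permutationOf : Shape → Permutation
permutationOf (full N)        = decreasing (suc N)
permutationOf (notched l p q) = decreasing (suc l) ⊖ (decreasing (suc p) ⊕ decreasing (suc q))

permutationOf-shape : ∀ s → PermHasShape (permutationOf s) s
permutationOf-shape (full N)        =
  refl , λ a<b → both-false (Fin.<-asym (opposite-anti a<b)) id
permutationOf-shape (notched l p q) =
  cong suc (sym (+-assoc l (suc p) (suc q))) ,
  ⊖-ascents (decreasing (suc l)) (decreasing (suc p) ⊕ decreasing (suc q))
    (decreasing-Decreasing (suc l))
    (⊕-ascents (decreasing (suc p)) (decreasing (suc q))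
      (decreasing-Decreasing (suc p)) (decreasing-Decreasing (suc q)))

PermHasShape-resp-≋ : ∀ {π σ s} → π ≋ σ → PermHasShape π s → PermHasShape σ s
PermHasShape-resp-≋ {s = s} π≋σ@(pointwise _) (size≡ , asc) =
  size≡ , ≋-HasAscents {R = Rises s} π≋σ asc

same-shape⇒≋ : ∀ {π σ s} → PermHasShape π s → PermHasShape σ s → π ≋ σ
same-shape⇒≋ {s = s} (size≡ , asc) (size≡′ , asc′) =
  determined (Rises s) (trans size≡ (sym size≡′)) asc asc′

-- The pair of the first position that starts an ascent and the last position.
top-corner : ∀ l p q → Rises (notched l p q) (suc l , width (notched l p q))
top-corner l p q = (≤-refl , m<m+n (suc l) z<s) , inner≤width l p q

-- The pair of the first position that starts an ascent and the first position
-- that ends one.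
inner-corner : ∀ l p q → Rises (notched l p q) (suc l , suc l + suc p)
inner-corner l p q = (≤-refl , m<m+n (suc l) z<s) , ≤-refl

suc-l< : ∀ l p q → suc l < width (notched l p q)
suc-l< l p q = <-≤-trans (m<m+n (suc l) z<s) (inner≤width l p q)

-- The parameters can be read off from the two corners and the length.
permutation-shape-unique : ∀ {π s t} → PermHasShape π s → PermHasShape π t → s ≡ t
permutation-shape-unique {π} {s} {t} (refl , asc) (size≡ , asc′) =
  match s t (suc-injective size≡)
    (HasAscents-unique π {Rises s} {Rises t} asc asc′)
    (λ {i} {j} i<j j< → HasAscents-unique π {Rises t} {Rises s} asc′ asc
                           i<j (subst (j <_) (sym size≡) j<))
  where
  _⇒_ : Shape → Shape → Set
  s ⇒ t = ∀ {i j} → i < j → j < suc (width s) → Rises s (i , j) → Rises t (i , j)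
  match : ∀ s t → width s ≡ width t → s ⇒ t → t ⇒ s → s ≡ t
  match (full N) (full N) refl _ _ = refl
  match (full N) (notched l p q) _ _ ⇐ = ⊥-elim (⇐ (suc-l< l p q) ≤-refl (top-corner l p q))
  match (notched l p q) (full N) _ ⇒ _ = ⊥-elim (⇒ (suc-l< l p q) ≤-refl (top-corner l p q))
  match (notched l p q) (notched l′ p′ q′) eq ⇒ ⇐
    with refl ← ≤-antisym (s≤s⁻¹ (proj₁ (proj₁ (⇐ (suc-l< l′ p′ q′) ≤-refl (top-corner l′ p′ q′)))))
                          (s≤s⁻¹ (proj₁ (proj₁ (⇒ (suc-l< l p q) ≤-refl (top-corner l p q)))))
    with refl ← suc-injective (+-cancelˡ-≡ (suc l) (suc p) (suc p′) (≤-antisym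
                  (proj₂ (⇐ (m<m+n (suc l) z<s) (s≤s (inner≤width l p′ q′)) (inner-corner l p′ q′)))
                  (proj₂ (⇒ (m<m+n (suc l) z<s) (s≤s (inner≤width l p q)) (inner-corner l p q)))))
    with refl ← +-cancelˡ-≡ (l + suc p) (suc q) (suc q′) eq
    = refl

-- The inversions are exactly the pairs of positions i < j that are not ascents.
inversions-shape : ∀ {π} s → PermHasShape π s → inversions π ≡ weight s
inversions-shape {_ , π} s (refl , asc) = go s (image position fwd inj onto listed)
  where
  N+1 : ℕ
  N+1 = suc (width s)
  listed : Enumerated (Inversion π) (inversions (N+1 , π))
  listed = filtered (inversion? π) (cartesianProduct (allFin N+1) (allFin N+1))
    (Unique.cartesianProduct⁺ (Unique.allFin⁺ N+1) (Unique.allFin⁺ N+1))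
    (λ _ → ∈-cartesianProduct⁺ (∈-allFin _) (∈-allFin _))
  position : Fin N+1 × Fin N+1 → ℕ × ℕ
  position (a , b) = toℕ a , toℕ b
  NonRise : Pred (ℕ × ℕ) 0ℓ
  NonRise x = Pair N+1 x × ¬ Rises s x
  fwd : ∀ {x} → Inversion π x → NonRise (position x)
  fwd {a , b} (a<b , des) = (a<b , Fin.toℕ<n b) , λ rise → Fin.<-asym des (from (asc a<b) rise)
  inj : ∀ {x y} → Inversion π x → Inversion π y → position x ≡ position y → x ≡ y
  inj _ _ eq = cong₂ _,_ (Fin.toℕ-injective (cong proj₁ eq)) (Fin.toℕ-injective (cong proj₂ eq))
  at : ∀ {i} → i < N+1 → Σ[ a ∈ Fin N+1 ] toℕ a ≡ i
  at i<n = fromℕ< i<n , Fin.toℕ-fromℕ< i<n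
  onto : ∀ {y} → NonRise y → Σ[ x ∈ Fin N+1 × Fin N+1 ] Inversion π x × position x ≡ y
  onto {i , j} ((i<j , j<n) , ¬rise) with at (<-trans i<j j<n) | at j<n
  ... | a , refl | b , refl =
    (a , b) , (i<j , ¬ascent⇒descent π i<j (¬rise ∘ to (asc i<j))) , refl
  go : ∀ s {m} → Enumerated (λ x → Pair (suc (width s)) x × ¬ Rises s x) m → m ≡ weight s
  go (full N) e = size-unique (proj₁ , (_, id)) e (pairs (suc N))
  go (notched l p q) e = notchWeight-unique l (suc p) (suc q) _
    (kept-pairs (suc l) (suc p) (suc l + suc p) (suc q) ≤-refl e)

-- The end of an ascent lies in the second run of the sum, which starts none.
shape⇒avoids-123 : ∀ {π} s → PermHasShape π s → Avoids π p123
shape⇒avoids-123 (full N) (_ , asc) (f , mono , iff) =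
  to (asc (mono {0F} {1F} (s≤s z≤n))) (to (iff 0F 1F) (s≤s z≤n))
shape⇒avoids-123 (notched l p q) (_ , asc) (f , mono , iff) =
  let (_ , e≤f₁)       = to (asc (mono {0F} {1F} (s≤s z≤n))) (to (iff 0F 1F) (s≤s z≤n))
      ((_ , f₁<e) , _) = to (asc (mono {1F} {2F} (s≤s (s≤s z≤n)))) (to (iff 1F 2F) (s≤s (s≤s z≤n)))
  in <⇒≱ f₁<e e≤f₁

-- An ascent continues to be one when its end is moved to the right.
shape⇒avoids-231 : ∀ {π} s → PermHasShape π s → Avoids π p231
shape⇒avoids-231 (full N) (_ , asc) (f , mono , iff) =
  to (asc (mono {0F} {1F} (s≤s z≤n))) (to (iff 0F 1F) (s≤s (s≤s z≤n)))
shape⇒avoids-231 (notched l p q) (_ , asc) (f , mono , iff) =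
  let (f₀∈ , e≤f₁) = to (asc (mono {0F} {1F} (s≤s z≤n))) (to (iff 0F 1F) (s≤s (s≤s z≤n)))
      f₁<f₂        = mono {1F} {2F} (s≤s (s≤s z≤n))
      f₀<f₂        = mono {0F} {2F} (s≤s z≤n)
  in Fin.<-asym (from (asc f₀<f₂) (f₀∈ , ≤-trans e≤f₁ (<⇒≤ f₁<f₂)))
                (to (iff 2F 0F) (s≤s z≤n))

¬ascent-at-0 : ∀ s {j} → ¬ Rises s (0 , j)
¬ascent-at-0 (full N) ()
¬ascent-at-0 (notched l p q) ((() , _) , _)

-- In a sum, the first position and the first one of the second summand form an
-- ascent.
shape⇒indecomposable : ∀ {π} s → PermHasShape π s → Indecomposable π
shape⇒indecomposable s hs@(refl , _) = s≤s z≤n , λ where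
  (ρ@(suc m , _) , τ@(suc n , _) , _ , _ , π≋) →
    let (_ , asc) = PermHasShape-resp-≋ {s = s} π≋ hs
    in ¬ascent-at-0 s (to (asc (↑ˡ<↑ʳ {n = suc n} 0F 0F)) (⊕-cross ρ τ 0F 0F))

-- Classification of the permutations

increasing₃ : (f : Fin 3 → Fin n) → f 0F Fin.< f 1F → f 1F Fin.< f 2F →
              ∀ {x y} → x Fin.< y → f x Fin.< f y
increasing₃ f f₀<f₁ f₁<f₂ {0F} {1F} _ = f₀<f₁
increasing₃ f f₀<f₁ f₁<f₂ {0F} {2F} _ = Fin.<-trans f₀<f₁ f₁<f₂
increasing₃ f f₀<f₁ f₁<f₂ {1F} {2F} _ = f₁<f₂
increasing₃ f f₀<f₁ f₁<f₂ {1F} {1F} (s≤s ())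
increasing₃ f f₀<f₁ f₁<f₂ {2F} {1F} (s≤s ())
increasing₃ f f₀<f₁ f₁<f₂ {2F} {2F} (s≤s (s≤s ()))

-- An occurrence of a pattern of length 3 is given by three positions
-- whose values, listed in the order prescribed by τ, increase.
contains₃ : (π : Permutation′ n) (τ : Permutation′ 3) (f : Fin 3 → Fin n) →
  f 0F Fin.< f 1F → f 1F Fin.< f 2F →
  let v = λ y → π ⟨$⟩ʳ f (τ ⟨$⟩ˡ y) in
  v 0F Fin.< v 1F → v 1F Fin.< v 2F → Contains (n , π) (3 , τ)
contains₃ π τ f f₀<f₁ f₁<f₂ v₀<v₁ v₁<v₂ =
  f , increasing₃ f f₀<f₁ f₁<f₂ , λ x y → mk⇔ (up x y) (down x y)
  where
  v : Fin 3 → Fin _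
  v y = π ⟨$⟩ʳ f (τ ⟨$⟩ˡ y)
  up : ∀ x y → τ ⟨$⟩ʳ x Fin.< τ ⟨$⟩ʳ y → π ⟨$⟩ʳ f x Fin.< π ⟨$⟩ʳ f y
  up x y lt = subst₂ (λ x y → π ⟨$⟩ʳ f x Fin.< π ⟨$⟩ʳ f y) (inverseˡ τ) (inverseˡ τ)
                (increasing₃ v v₀<v₁ v₁<v₂ lt)
  down : ∀ x y → π ⟨$⟩ʳ f x Fin.< π ⟨$⟩ʳ f y → τ ⟨$⟩ʳ x Fin.< τ ⟨$⟩ʳ y
  down x y lt with Fin.<-cmp (τ ⟨$⟩ʳ x) (τ ⟨$⟩ʳ y)
  ... | tri< τx<τy _ _ = τx<τy
  ... | tri≈ _ eq _    = ⊥-elim (Fin.<-irrefl (cong (λ x → π ⟨$⟩ʳ f x) (injective τ eq)) lt)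
  ... | tri> _ _ τy<τx = ⊥-elim (Fin.<-asym lt (up y x τy<τx))

triple : Fin n → Fin n → Fin n → Fin 3 → Fin n
triple a b c 0F = a
triple a b c 1F = b
triple a b c 2F = c

-- Either P holds nowhere, or it holds at a least position.
least? : {P : Pred (Fin n) 0ℓ} → Decidable P →
         (∀ a → ¬ P a) ⊎ Σ[ a ∈ Fin n ] P a × (∀ {b} → b Fin.< a → ¬ P b)
least? {zero}  P? = inj₁ λ ()
least? {suc n} P? with P? zero
... | yes P₀ = inj₂ (zero , P₀ , λ ())
... | no ¬P₀ with least? (P? ∘ suc)
...   | inj₁ none = inj₁ λ { zero → ¬P₀ ; (suc a) → none a }
...   | inj₂ (a , Pa , min) = inj₂ (suc a , Pa , λ { {zero} _ → ¬P₀ ; {suc b} (s≤s b<a) → min b<a })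

module _ (π : Permutation′ n) where

  -- The pair (a , b) of positions is an ascent.
  AscendsTo : Fin n → Fin n → Set
  AscendsTo a b = a Fin.< b × π ⟨$⟩ʳ a Fin.< π ⟨$⟩ʳ b

  ascendsTo? : ∀ a → Decidable (AscendsTo a)
  ascendsTo? a b = (a Fin.<? b) ×-dec (π ⟨$⟩ʳ a Fin.<? π ⟨$⟩ʳ b)

module _ (π : Permutation′ n)
         (avoids-123 : Avoids (n , π) p123) (avoids-231 : Avoids (n , π) p231) where

  no-123 : ∀ {a b c} → a Fin.< b → b Fin.< c →
           π ⟨$⟩ʳ a Fin.< π ⟨$⟩ʳ b → ¬ (π ⟨$⟩ʳ b Fin.< π ⟨$⟩ʳ c)
  no-123 a<b b<c v₀<v₁ v₁<v₂ =
    avoids-123 (contains₃ π Perm.id (triple _ _ _) a<b b<c v₀<v₁ v₁<v₂)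

  no-231 : ∀ {a b c} → a Fin.< b → b Fin.< c →
           π ⟨$⟩ʳ c Fin.< π ⟨$⟩ʳ a → ¬ (π ⟨$⟩ʳ a Fin.< π ⟨$⟩ʳ b)
  no-231 a<b b<c v₀<v₁ v₁<v₂ =
    avoids-231 (contains₃ π (proj₂ p231) (triple _ _ _) a<b b<c v₀<v₁ v₁<v₂)

  -- Let c be the first position that starts an ascent, and e the first position
  -- that ends an ascent from c.
  module _ {c e : Fin n} (c<e : c Fin.< e) (πc<πe : π ⟨$⟩ʳ c Fin.< π ⟨$⟩ʳ e)
           (c-least : ∀ {a} → a Fin.< c → ¬ ∃ (AscendsTo π a))
           (e-least : ∀ {b} → b Fin.< e → ¬ AscendsTo π c b) where

    below-c : ∀ {a} → c Fin.< a → a Fin.< e → π ⟨$⟩ʳ a Fin.< π ⟨$⟩ʳ c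
    below-c c<a a<e = ¬ascent⇒descent π c<a (λ lt → e-least a<e (c<a , lt))

    above-c : ∀ {b} → e Fin.< b → π ⟨$⟩ʳ c Fin.< π ⟨$⟩ʳ b
    above-c e<b with Fin.<-cmp (π ⟨$⟩ʳ c) (π ⟨$⟩ʳ _)
    ... | tri< lt _ _ = lt
    ... | tri≈ _ eq _ = ⊥-elim (Fin.<-irrefl (injective π eq) (Fin.<-trans c<e e<b))
    ... | tri> _ _ gt = ⊥-elim (no-231 c<e e<b gt πc<πe)

    ascents-block : ∀ {u} → toℕ c + u ≡ toℕ e → HasAscents (n , π) (Block (toℕ c) u (toℕ e))
    ascents-block {u} c+u≡e {a} {b} a<b rewrite c+u≡e = mk⇔
      (λ asc → (≮⇒≥ (λ a<c → c-least a<c (b , a<b , asc)) , ≰⇒> (e≰a asc)) , ≮⇒≥ (b≮e asc))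
      (λ ((c≤a , a<e) , e≤b) → ≤-<-trans (lower c≤a a<e) (upper e≤b))
      where
      -- The values at c, …, e - 1 are at most that at c, and the values at
      -- e, e + 1, … exceed it.
      lower : toℕ c ≤ toℕ a → a Fin.< e → π ⟨$⟩ʳ a Fin.≤ π ⟨$⟩ʳ c
      lower c≤a a<e with m≤n⇒m<n∨m≡n c≤a
      ... | inj₁ c<a = <⇒≤ (below-c c<a a<e)
      ... | inj₂ c≡a = ≤-reflexive (cong (λ x → toℕ (π ⟨$⟩ʳ x)) (sym (Fin.toℕ-injective c≡a)))
      upper : ∀ {b} → toℕ e ≤ toℕ b → π ⟨$⟩ʳ c Fin.< π ⟨$⟩ʳ b
      upper e≤b with m≤n⇒m<n∨m≡n e≤b
      ... | inj₁ e<b = above-c e<b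
      ... | inj₂ e≡b = subst (λ x → π ⟨$⟩ʳ c Fin.< π ⟨$⟩ʳ x) (Fin.toℕ-injective e≡b) πc<πe
      -- An ascent that starts at e or later is preceded by a smaller value at c.
      e≰a : π ⟨$⟩ʳ a Fin.< π ⟨$⟩ʳ b → ¬ (toℕ e ≤ toℕ a)
      e≰a asc e≤a = no-123 (<-≤-trans c<e e≤a) a<b (upper e≤a) asc
      -- An ascent that starts after c and ends before e is followed by a larger
      -- value at e.
      b≮e : π ⟨$⟩ʳ a Fin.< π ⟨$⟩ʳ b → ¬ (b Fin.< e)
      b≮e asc b<e with m≤n⇒m<n∨m≡n (≮⇒≥ (λ a<c → c-least a<c (b , a<b , asc)))
      ... | inj₁ c<a = no-123 a<b b<e asc (Fin.<-trans (below-c (<-trans c<a a<b) b<e) πc<πe)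
      ... | inj₂ c≡a with refl ← Fin.toℕ-injective c≡a = e-least b<e (a<b , asc)

-- A permutation with the ascents of a sum of two decreasing permutations is
-- that sum.
decomposable-at : ∀ {π p q} → size π ≡ suc p + suc q →
  HasAscents π (Block 0 (suc p) (suc p)) → Decomposable π
decomposable-at {p = p} {q} size≡ asc =
  decreasing (suc p) , decreasing (suc q) , s≤s z≤n , s≤s z≤n ,
  determined (Block 0 (suc p) (suc p)) size≡ asc
    (⊕-ascents (decreasing (suc p)) (decreasing (suc q))
      (decreasing-Decreasing (suc p)) (decreasing-Decreasing (suc q)))

classification : ∀ π → Indecomposable π → Avoids π p123 → Avoids π p231 →
                 ∃ (PermHasShape π)
classification (suc n , π) (_ , ¬dec) a123 a231
  with least? (λ a → Fin.any? (ascendsTo? π a))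
... | inj₁ none = full n , refl , λ a<b →
        both-false (λ asc → none _ (_ , a<b , asc)) id
... | inj₂ (c , (e′ , c↗e′) , c-least) with least? (ascendsTo? π c)
...   | inj₁ none = ⊥-elim (none e′ c↗e′)
...   | inj₂ (e , (c<e , πc<πe) , e-least)
  with p , c+p≡e ← m≤n⇒∃[o]m+o≡n c<e | q , e+q≡n ← m≤n⇒∃[o]m+o≡n (Fin.toℕ<n e)
  = go (toℕ c) (toℕ e) (trans (+-suc (toℕ c) p) c+p≡e) (trans (sym e+q≡n) (sym (+-suc (toℕ e) q)))
       (ascents-block π a123 a231 c<e πc<πe c-least e-least (trans (+-suc (toℕ c) p) c+p≡e))
  where
  go : ∀ {p q} c e → c + suc p ≡ e → suc n ≡ e + suc q →
       HasAscents (suc n , π) (Block c (suc p) e) → ∃ (PermHasShape (suc n , π))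
  -- An ascent from the first position would make the permutation decomposable.
  go zero    e refl size≡ asc = ⊥-elim (¬dec (decomposable-at size≡ asc))
  go (suc l) e refl size≡ asc = notched l _ _ , size≡ , asc

-- The fountains of each shape

-- The missing coins, as far as they lie in the triangle: the conditions that
-- define the triangle are not repeated here.
Notch : Shape → Pred Coin 0ℓ
Notch (full N)        _ = ⊥
Notch (notched l p q) c = upRight c ≤ suc p × suc l + suc p ≤ upLeft c

notch? : ∀ s → Decidable (Notch s)
notch? (full N)        _ = no id
notch? (notched l p q) c = (upRight c ≤? suc p) ×-dec (suc l + suc p ≤? upLeft c)

-- F consists of the coins of the triangle outside the notch of s.
record FountainHasShape (F : Fountain) (s : Shape) : Set where
  constructor _,_
  field
    width≡  : Fountain.width F ≡ width s
    missing : ∀ {c} → Triangle (width s) c → (¬ Coins F c) ⇔ Notch s c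

triangle? : ∀ N → Decidable (Triangle N)
triangle? N (h , p) = (1 ≤? p) ×-dec (p + h ≤? N)

notch-up : ∀ s {h x} → Notch s (h , x) → Notch s (suc h , x)
notch-up (notched l p q) {h} {x} (x≤ , ≤x+h) = x≤ , ≤-trans ≤x+h (+-monoʳ-≤ x (n≤1+n h))

notch-left : ∀ s {h x} → Notch s (h , suc x) → Notch s (suc h , x)
notch-left (notched l p q) {h} {x} (x≤ , ≤x+h) =
  ≤-trans (n≤1+n x) x≤ , subst (suc l + suc p ≤_) (sym (+-suc x h)) ≤x+h

¬notch-bottom : ∀ s {x} → ¬ Notch s (0 , x)
¬notch-bottom (notched l p q) {x} (x≤ , ≤x+0) =
  <⇒≱ (m<n+m (suc p) {suc l} z<s)
      (≤-trans ≤x+0 (≤-trans (≤-reflexive (+-identityʳ x)) x≤))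

fountainOf : Shape → Fountain
fountainOf s = record
  { width     = width s
  ; Coins     = λ c → Triangle (width s) c × ¬ Notch s c
  ; coin?     = λ c → triangle? (width s) c ×-dec ¬? (notch? s c)
  ; inside    = proj₁
  ; bottom    = λ {x} 1≤x x≤N →
      (1≤x , subst (_≤ width s) (sym (+-identityʳ x)) x≤N) , ¬notch-bottom s
  ; supported = λ {h} {x} ((1≤x , ≤N) , ¬notch) →
      ((1≤x , ≤-trans (+-monoʳ-≤ x (n≤1+n h)) ≤N) , ¬notch ∘ notch-up s) ,
      ((s≤s z≤n , subst (_≤ width s) (+-suc x h) ≤N) , ¬notch ∘ notch-left s)
  }

fountainOf-shape : ∀ s → FountainHasShape (fountainOf s) s
fountainOf-shape s = refl , λ {c} c∈T → mk⇔
  (λ ¬coin → decidable-stable (notch? s c) (λ ¬notch → ¬coin (c∈T , ¬notch)))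
  (λ notch (_ , ¬notch) → ¬notch notch)

same-shape⇒⊆ : ∀ {F G s} → FountainHasShape F s → FountainHasShape G s →
               ∀ {c} → Coins F c → Coins G c
same-shape⇒⊆ {F} {G} (refl , F-missing) (_ , G-missing) {c} c∈F with coin? G c
... | yes c∈G = c∈G
... | no  c∉G = ⊥-elim (from (F-missing c∈T) (to (G-missing c∈T) c∉G) c∈F)
  where c∈T = inside F c∈F

same-shape⇒≐ : ∀ {F G s} → FountainHasShape F s → FountainHasShape G s →
               Coins F ≐ Coins G
same-shape⇒≐ {F} {G} F-shape G-shape =
  same-shape⇒⊆ {F} {G} F-shape G-shape , same-shape⇒⊆ {G} {F} G-shape F-shape

-- The width is the number of the last coin of the bottom row.
width-≤ : ∀ {F G} → Coins F ≐ Coins G → Fountain.width F ≤ Fountain.width G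
width-≤ {F} {G} (F⊆G , _) = bound (Fountain.width F) ≤-refl
  where
  bound : ∀ w → w ≤ Fountain.width F → w ≤ Fountain.width G
  bound zero    _ = z≤n
  bound (suc w) w< = subst (_≤ Fountain.width G) (+-identityʳ (suc w))
                       (proj₂ (inside G (F⊆G (bottom F (s≤s z≤n) w<))))

-- The coin on the up-right diagonal x and the up-left diagonal y.
crossing : ∀ {N x y} → 1 ≤ x → x ≤ y → y ≤ N → Σ[ h ∈ ℕ ] x + h ≡ y × Triangle N (h , x)
crossing {N} 1≤x x≤y y≤N with h , refl ← m≤n⇒∃[o]m+o≡n x≤y = h , refl , 1≤x , y≤N

-- Within the triangle of s, the coins missing from s are missing from t.
_⇒_ : Shape → Shape → Set
s ⇒ t = ∀ {c} → Triangle (width s) c → Notch s c → Notch t c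

suc-p≤inner : ∀ l p → suc p ≤ suc l + suc p
suc-p≤inner l p = m≤n+m (suc p) (suc l)

¬notched⇒full : ∀ {l p q N} → ¬ (notched l p q ⇒ full N)
¬notched⇒full {l} {p} {q} ⇒
  with h , refl , c∈T ← crossing (s≤s z≤n) (≤-trans (s≤s z≤n) (suc-p≤inner l p))
                          (inner≤width l p q) =
  ⇒ c∈T (s≤s z≤n , ≤-refl)

-- Within its width the notch is determined by the first and the last of its coins
-- on the up-left diagonal l + p + 2; they lie on the up-right diagonals 1 and
-- p + 1.
notch-≤ : ∀ {l p q l′ p′ q′} → notched l p q ⇒ notched l′ p′ q′ →
          p ≤ p′ × suc l′ + suc p′ ≤ suc l + suc p
notch-≤ {l} {p} {q} ⇒
  with h , refl , c∈T ← crossing (s≤s z≤n) (≤-trans (s≤s z≤n) (suc-p≤inner l p))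
                          (inner≤width l p q)
  with k , k≡ , d∈T ← crossing (s≤s z≤n) (suc-p≤inner l p) (inner≤width l p q) =
  s≤s⁻¹ (proj₁ (⇒ d∈T (≤-refl , ≤-reflexive (sym k≡)))) , proj₂ (⇒ c∈T (s≤s z≤n , ≤-refl))

shapes-match : ∀ s t → width s ≡ width t → s ⇒ t → t ⇒ s → s ≡ t
shapes-match (full N) (full N) refl _ _ = refl
shapes-match (full N) (notched l p q) _ _ ⇐ = ⊥-elim (¬notched⇒full {l} {p} {q} {N} ⇐)
shapes-match (notched l p q) (full N) _ ⇒ _ = ⊥-elim (¬notched⇒full {l} {p} {q} {N} ⇒)
shapes-match (notched l p q) (notched l′ p′ q′) eq ⇒ ⇐
  with p≤p′ , b′≤b ← notch-≤ {l} {p} {q} {l′} {p′} {q′} ⇒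
  with p′≤p , b≤b′ ← notch-≤ {l′} {p′} {q′} {l} {p} {q} ⇐
  with refl ← ≤-antisym p≤p′ p′≤p
  with refl ← suc-injective (+-cancelʳ-≡ (suc p) (suc l) (suc l′) (≤-antisym b≤b′ b′≤b))
  with refl ← +-cancelˡ-≡ (l + suc p) (suc q) (suc q′) eq
  = refl

fountain-shape-unique : ∀ {F G s t} → Coins F ≐ Coins G →
  FountainHasShape F s → FountainHasShape G t → s ≡ t
fountain-shape-unique {F} {G} {s} {t} F≐G (F-width , F-missing) (G-width , G-missing) =
  shapes-match s t same-width
    (λ c∈T notch → to (G-missing (subst (λ N → Triangle N _) same-width c∈T))
                     (from (F-missing c∈T) notch ∘ proj₂ F≐G))
    (λ c∈T notch → to (F-missing (subst (λ N → Triangle N _) (sym same-width) c∈T))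
                     (from (G-missing c∈T) notch ∘ proj₁ F≐G))
  where
  same-width : width s ≡ width t
  same-width = subst₂ _≡_ F-width G-width
    (≤-antisym (width-≤ {F} {G} F≐G) (width-≤ {G} {F} (≐-sym F≐G)))

-- The missing coins as pairs of diagonals, the up-right ones numbered from 0.
Cut : Shape → Pred (ℕ × ℕ) 0ℓ
Cut (full N)        _ = ⊥
Cut (notched l p q) x = Block 0 (suc p) (suc l + suc p) x

notch⇔cut : ∀ s {h x} → Notch s (h , suc x) ⇔ Cut s (x , suc x + h)
notch⇔cut (full N)        = mk⇔ id id
notch⇔cut (notched l p q) = mk⇔ (λ (x< , ≤y) → (z≤n , x<) , ≤y) (λ ((_ , x<) , ≤y) → x< , ≤y)

coinCount-shape : ∀ {F} s → FountainHasShape F s → coinCount F ≡ weight s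
coinCount-shape {F} s (refl , missing) = count s (image diagonals fwd inj onto listed)
  where
  N = width s
  listed : Enumerated (Coins F) (coinCount F)
  listed = filtered (coin? F) (cartesianProduct (upTo N) (map suc (upTo N)))
    (Unique.cartesianProduct⁺ (Unique.upTo⁺ N) (Unique.map⁺ suc-injective (Unique.upTo⁺ N)))
    all
    where
    all : ∀ {c} → Coins F c → _
    all {h , suc x} c∈F with _ , x+h<N ← inside F c∈F = ∈-cartesianProduct⁺
      (∈-upTo⁺ (≤-trans (s≤s (m≤n+m h x)) x+h<N))
      (∈-map⁺ suc (∈-upTo⁺ (≤-trans (s≤s (m≤m+n x h)) x+h<N)))
    all {h , zero} c∈F with () , _ ← inside F c∈F

  diagonals : Coin → ℕ × ℕ
  diagonals c = pred (upRight c) , upLeft c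

  Kept : Pred (ℕ × ℕ) 0ℓ
  Kept x = Pair (suc N) x × ¬ Cut s x
  fwd : ∀ {c} → Coins F c → Kept (diagonals c)
  fwd {h , zero}  c∈F with () , _ ← inside F c∈F
  fwd {h , suc x} c∈F =
    (s≤s (m≤m+n x h) , s≤s (proj₂ (inside F c∈F))) ,
    λ cut → from (missing (inside F c∈F)) (from (notch⇔cut s) cut) c∈F
  inj : ∀ {c d} → Coins F c → Coins F d → diagonals c ≡ diagonals d → c ≡ d
  inj {_ , zero} c∈F _ _ with () , _ ← inside F c∈F
  inj {_} {_ , zero} _ d∈F _ with () , _ ← inside F d∈F
  inj {h , suc x} {h′ , suc x′} _ _ eq with refl ← cong proj₁ eq =
    cong (_, suc x) (+-cancelˡ-≡ (suc x) h h′ (cong proj₂ eq))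
  onto : ∀ {y} → Kept y → Σ[ c ∈ Coin ] Coins F c × diagonals c ≡ y
  onto {i , j} ((i<j , j≤N) , ¬cut) with h , refl ← m≤n⇒∃[o]m+o≡n i<j
    with coin? F (h , suc i)
  ... | yes c∈F = (h , suc i) , c∈F , refl
  ... | no  c∉F = ⊥-elim (¬cut (to (notch⇔cut s) (to (missing (s≤s z≤n , s≤s⁻¹ j≤N)) c∉F)))

  count : ∀ s {m} → Enumerated (λ x → Pair (suc (width s)) x × ¬ Cut s x) m → m ≡ weight s
  count (full N)        e = size-unique (proj₁ , (_, id)) e (pairs (suc N))
  count (notched l p q) e = notchWeight-unique l (suc p) (suc q) _
    (kept-pairs 0 (suc p) (suc l + suc p) (suc q) (suc-p≤inner l p) e)

-- Classification of the fountains

shape⇒rectangle : ∀ {F} s → FountainHasShape F s → IsRectangle (Fountain.width F) (Missing F)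
shape⇒rectangle (full N) (refl , missing) = empty λ c (c∈T , c∉F) → to (missing c∈T) c∉F
shape⇒rectangle {F} (notched l p q) (refl , missing) =
  spanned {a₁ = 1} {suc p} {suc l + suc p} {width (notched l p q)}
    (s≤s z≤n) (inner≤width l p q)
    (λ (1≤x , x≤) → 1≤x , ≤-trans x≤ (≤-trans (suc-p≤inner l p) (inner≤width l p q)))
    (λ (≤y , y≤) → ≤-trans (s≤s z≤n) ≤y , y≤)
    (λ (_ , a≤) (≤b , _) → ≤-trans a≤ (≤-trans (suc-p≤inner l p) ≤b))
    ( (λ (c∈T , c∉F) → let (x≤ , ≤y) = to (missing c∈T) c∉F
                       in c∈T , (proj₁ c∈T , x≤) , (≤y , proj₂ c∈T))
    , (λ (c∈T , (_ , x≤) , (≤y , _)) → c∈T , from (missing c∈T) (x≤ , ≤y)))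

-- As the coins of a fountain are supported, the coins above a missing coin are
-- missing; hence a non-empty rectangle of missing coins contains the apex.
rectangle⇒shape : ∀ F → IsRectangle (Fountain.width F) (Missing F) → ∃ (FountainHasShape F)
rectangle⇒shape F (empty none) =
  full _ , refl , λ c∈T → mk⇔ (λ c∉F → none _ (c∈T , c∉F)) λ ()
rectangle⇒shape F (spanned {a₁} {a₂} {b₁} {b₂} a₁≤a₂ b₁≤b₂ A⊆ B⊆ A≤B (M⊆R , R⊆M)) =
  build a₁≡1 a₂<b₁ b₂≡N
  where
  N = Fountain.width F
  1≤a₁ : 1 ≤ a₁
  1≤a₁ = proj₁ (A⊆ (≤-refl , a₁≤a₂))
  b₂≤N : b₂ ≤ N
  b₂≤N = proj₂ (B⊆ (b₁≤b₂ , ≤-refl))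
  a₂≤b₁ : a₂ ≤ b₁
  a₂≤b₁ = A≤B (a₁≤a₂ , ≤-refl) (≤-refl , b₁≤b₂)

  -- If a₂ were equal to b₁, the rectangle would contain the coin (0 , a₂).
  a₂<b₁ : a₂ < b₁
  a₂<b₁ = ≤∧≢⇒< a₂≤b₁ λ a₂≡b₁ →
    let a₂≤N = ≤-trans a₂≤b₁ (≤-trans b₁≤b₂ b₂≤N)
        1≤a₂ = ≤-trans 1≤a₁ a₁≤a₂
        a₂+0≡ = +-identityʳ a₂
        (_ , c∉F) = R⊆M {0 , a₂}
          ( (1≤a₂ , ≤-trans (≤-reflexive a₂+0≡) a₂≤N)
          , (a₁≤a₂ , ≤-refl)
          , (≤-reflexive (trans (sym a₂≡b₁) (sym a₂+0≡))
          ,  ≤-trans (≤-reflexive (trans a₂+0≡ a₂≡b₁)) b₁≤b₂))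
    in c∉F (bottom F 1≤a₂ a₂≤N)

  a₁≤b₂ : a₁ ≤ b₂
  a₁≤b₂ = ≤-trans a₁≤a₂ (≤-trans a₂≤b₁ b₁≤b₂)

  -- The top coin of the rectangle, where its first up-right diagonal meets its
  -- last up-left diagonal.
  corner-missing : ∀ {h} → a₁ + h ≡ b₂ → ¬ Coins F (h , a₁)
  corner-missing eq = proj₂ (R⊆M ((1≤a₁ , ≤-trans (≤-reflexive eq) b₂≤N) , (≤-refl , a₁≤a₂) ,
                                  (≤-trans b₁≤b₂ (≤-reflexive (sym eq)) , ≤-reflexive eq)))

  in-rectangle : ∀ {c} → Triangle N c → ¬ Coins F c → a₁ ≤ upRight c × upLeft c ≤ b₂
  in-rectangle c∈T c∉F = let (_ , (a₁≤ , _) , (_ , ≤b₂)) = M⊆R (c∈T , c∉F) in a₁≤ , ≤b₂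

  -- The coins directly above the top coin of the rectangle are absent from the
  -- fountain but outside the rectangle, hence also outside the triangle.
  a₁≡1 : a₁ ≡ 1
  a₁≡1 with m≤n⇒∃[o]m+o≡n a₁≤b₂ | m≤n⇒∃[o]m+o≡n 1≤a₁
  ... | h , eq | zero  , 1+0≡a₁ = sym 1+0≡a₁
  ... | h , eq | suc a , refl = ⊥-elim (1+n≰n (proj₁ (in-rectangle {suc h , suc a}
          (s≤s z≤n , ≤-trans (≤-reflexive (trans (+-suc (suc a) h) eq)) b₂≤N)
          (λ c∈F → corner-missing eq (proj₂ (supported F c∈F))))))

  b₂≡N : b₂ ≡ N
  b₂≡N with m≤n⇒∃[o]m+o≡n a₁≤b₂ | m≤n⇒m<n∨m≡n b₂≤N
  ... | h , eq | inj₂ b₂≡N = b₂≡N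
  ... | h , eq | inj₁ b₂<N =
    let eq′ = trans (+-suc a₁ h) (cong suc eq) in
    ⊥-elim (1+n≰n (subst (_≤ b₂) eq′ (proj₂ (in-rectangle {suc h , a₁}
      (1≤a₁ , ≤-trans (≤-reflexive eq′) b₂<N)
      (λ c∈F → corner-missing eq (proj₁ (supported F c∈F)))))))

  build : a₁ ≡ 1 → a₂ < b₁ → b₂ ≡ N → ∃ (FountainHasShape F)
  build refl a₂<b₁ b₂≡N
    with p , refl ← m≤n⇒∃[o]m+o≡n a₁≤a₂ | q , b₁+q≡b₂ ← m≤n⇒∃[o]m+o≡n b₁≤b₂
    with l , a₂+l≡b₁ ← m≤n⇒∃[o]m+o≡n a₂<b₁ =
    notched l p q , N≡ , λ c∈T′ → let c∈T = subst (λ N → Triangle N _) (sym N≡) c∈T′ in mk⇔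
      (λ c∉F → let (_ , (_ , x≤) , (≤y , _)) = M⊆R (c∈T , c∉F)
               in x≤ , ≤-trans (≤-reflexive b₁≡) ≤y)
      (λ (x≤ , ≤y) → proj₂ (R⊆M (c∈T , (proj₁ c∈T , x≤) ,
         (≤-trans (≤-reflexive (sym b₁≡)) ≤y , ≤-trans (proj₂ c∈T) (≤-reflexive (sym b₂≡N))))))
    where
    b₁≡ : suc l + suc p ≡ b₁
    b₁≡ = trans (cong suc (+-comm l (suc p))) a₂+l≡b₁
    N≡ : N ≡ (l + suc p) + suc q
    N≡ = trans (sym b₂≡N) (trans (sym b₁+q≡b₂)
           (trans (cong (_+ q) (sym b₁≡)) (sym (+-suc (l + suc p) q))))

-- The generating function

x^-zero : ∀ {w k} → k < w → (x^ w) k ≡ 0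
x^-zero {w} {k} k<w with w ≟ k
... | yes refl = ⊥-elim (1+n≰n k<w)
... | no  _    = refl

sumOver-zero : ∀ is f k → (∀ {i} → i ∈ is → f i k ≡ 0) → sumOver is f k ≡ 0
sumOver-zero []       f k zeros = refl
sumOver-zero (i ∷ is) f k zeros = cong₂ _+_ (zeros (here refl)) (sumOver-zero is f k (zeros ∘ there))

-- The list of the indices 1, …, n.
oneTo : ℕ → List ℕ
oneTo n = map suc (upTo n)

sumOver-suc : ∀ n f k → sumOver (oneTo (suc n)) f k ≡ sumOver (oneTo n) f k + f (suc n) k
sumOver-suc n f k = begin
  sumOver (map suc (upTo (suc n))) f k
    ≡⟨ cong (λ is → sumOver (map suc is) f k) (upTo-∷ʳ n) ⟨
  sumOver (map suc (upTo n ++ n ∷ [])) f k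
    ≡⟨ cong (λ is → sumOver is f k) (map-++ suc (upTo n) (n ∷ [])) ⟩
  sumOver (oneTo n ++ suc n ∷ []) f k
    ≡⟨ cong sum (map-++ (λ i → f i k) (oneTo n) (suc n ∷ [])) ⟩
  sum (map (λ i → f i k) (oneTo n) ++ f (suc n) k ∷ [])
    ≡⟨ sum-++ (map (λ i → f i k) (oneTo n)) (f (suc n) k ∷ []) ⟩
  sumOver (oneTo n) f k + (f (suc n) k + 0)
    ≡⟨ cong (sumOver (oneTo n) f k +_) (+-identityʳ (f (suc n) k)) ⟩
  sumOver (oneTo n) f k + f (suc n) k
    ∎
  where
  open ≡-Reasoning

-- A sum of series converges when, for each k, the terms with index above M k do
-- not contribute to the coefficient of x^k.
sums-to : ∀ {f} (M : ℕ → ℕ) → (∀ {i k} → M k < i → f i k ≡ 0) →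
          ∑≥1 f ↦ (λ k → sumOver (oneTo (M k)) f k)
sums-to {f} M vanish k = M k , λ n M≤n → let (d , M+d≡n) = m≤n⇒∃[o]m+o≡n M≤n in
  subst (λ n → sumOver (oneTo n) f k ≡ sumOver (oneTo (M k)) f k) M+d≡n (stable d)
  where
  stable : ∀ d → sumOver (oneTo (M k + d)) f k ≡ sumOver (oneTo (M k)) f k
  stable zero    = cong (λ n → sumOver (oneTo n) f k) (+-identityʳ (M k))
  stable (suc d) = begin
    sumOver (oneTo (M k + suc d)) f k
      ≡⟨ cong (λ n → sumOver (oneTo n) f k) (+-suc (M k) d) ⟩
    sumOver (oneTo (suc (M k + d))) f k                  ≡⟨ sumOver-suc (M k + d) f k ⟩
    sumOver (oneTo (M k + d)) f k + f (suc (M k + d)) k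
      ≡⟨ cong₂ _+_ (stable d) (vanish (s≤s (m≤m+n (M k) d))) ⟩
    sumOver (oneTo (M k)) f k + 0                        ≡⟨ +-identityʳ _ ⟩
    sumOver (oneTo (M k)) f k                            ∎
    where open ≡-Reasoning

triangle≤notchWeightˡ : ∀ i {j l} → l ≤ j → triangle i ≤ notchWeight i j l
triangle≤notchWeightˡ i {j} {l} l≤j =
  subst (triangle i ≤_) (sym (+-∸-assoc (triangle i) (triangle-mono l≤j))) (m≤m+n _ _)

triangle≤notchWeightʳ : ∀ j {i l} → l ≤ i → triangle j ≤ notchWeight i j l
triangle≤notchWeightʳ j {i} {l} l≤i =
  subst (λ t → triangle j ≤ t ∸ triangle l) (+-comm (triangle j) (triangle i))
    (triangle≤notchWeightˡ j l≤i)

-- The bounds k + 1 and k suffice for the coefficient of x^k: the exponents are at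
-- least i - 1 in the simple sum, and at least i and j in the double sum.
fullSeries : Series
fullSeries k = sumOver (oneTo (suc k)) (λ i → x^ (i C 2)) k

notchedTerm : ℕ → ℕ → Series
notchedTerm i j = sumOver (upTo (i ⊓ j)) (λ l → x^ (notchWeight i j l))

notchedRow : ℕ → Series
notchedRow i k = sumOver (oneTo k) (notchedTerm i) k

notchedSeries : Series
notchedSeries k = sumOver (oneTo k) notchedRow k

⊓-left : ∀ {l} i j → l < i ⊓ j → l < i
⊓-left i j l< = <-≤-trans l< (m⊓n≤m i j)

⊓-right : ∀ {l} i j → l < i ⊓ j → l < j
⊓-right i j l< = <-≤-trans l< (m⊓n≤n i j)

fullSeries-sum : ∑≥1 (λ i → x^ (i C 2)) ↦ fullSeries
fullSeries-sum = sums-to suc λ { {suc i} {k} (s≤s k<i) → x^-zero (<-≤-trans k<i (n≤C2 i)) }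
  where
  n≤C2 : ∀ i → i ≤ suc i C 2
  n≤C2 i = subst (i ≤_) (sym (triangle≡ i)) (n≤triangle i)

notchedTerm-zeroˡ : ∀ {i k} j → k < i → notchedTerm i j k ≡ 0
notchedTerm-zeroˡ {i} {k} j k<i =
  sumOver-zero (upTo (i ⊓ j)) (λ l → x^ (notchWeight i j l)) k λ l∈ → x^-zero (<-≤-trans k<i (≤-trans (n≤triangle i)
    (triangle≤notchWeightˡ i {j} (<⇒≤ (⊓-right i j (∈-upTo⁻ l∈))))))

notchedTerm-zeroʳ : ∀ {j k} i → k < j → notchedTerm i j k ≡ 0
notchedTerm-zeroʳ {j} {k} i k<j =
  sumOver-zero (upTo (i ⊓ j)) (λ l → x^ (notchWeight i j l)) k λ l∈ → x^-zero (<-≤-trans k<j (≤-trans (n≤triangle j)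
    (triangle≤notchWeightʳ j {i} (<⇒≤ (⊓-left i j (∈-upTo⁻ l∈))))))

notchedRow-sum : ∀ i → ∑≥1 (notchedTerm i) ↦ notchedRow i
notchedRow-sum i = sums-to id (notchedTerm-zeroʳ i)

notchedSeries-sum : ∑≥1 notchedRow ↦ notchedSeries
notchedSeries-sum = sums-to id λ {i} {k} k<i →
  sumOver-zero (oneTo k) (notchedTerm i) k (λ {j} _ → notchedTerm-zeroˡ j k<i)

-- Enumeration of the shapes by weight

oneTo⁺ : ∀ {n i} → i < n → suc i ∈ oneTo n
oneTo⁺ i<n = ∈-map⁺ suc (∈-upTo⁺ i<n)

unique-oneTo : ∀ n → Unique (oneTo n)
unique-oneTo n = Unique.map⁺ suc-injective (Unique.upTo⁺ n)

OfWeight : ℕ → Pred Shape 0ℓ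
OfWeight k s = weight s ≡ k

IsFull : Pred Shape 0ℓ
IsFull s = ∃[ N ] s ≡ full N

IsNotched : Pred Shape 0ℓ
IsNotched s = ∃[ l ] ∃[ p ] ∃[ q ] s ≡ notched l p q

-- The term i of the simple sum belongs to the width i - 1.
fullShapes : ∀ k → Enumerated (λ s → IsFull s × OfWeight k s) (fullSeries k)
fullShapes k = image (λ (i , _) → full (pred i)) fwd (λ {x} {y} → inj {x} {y}) onto
  (indexed {P = λ i (_ : ⊤) → i C 2 ≡ k} (unique-oneTo (suc k)) (λ _ → monomial _ k))
  where
  Index : Pred (ℕ × ⊤) 0ℓ
  Index (i , _) = i ∈ oneTo (suc k) × i C 2 ≡ k
  fwd : ∀ {x} → Index x → IsFull (full (pred (proj₁ x))) × OfWeight k (full (pred (proj₁ x)))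
  fwd (i∈ , eq) with _ , _ , refl ← ∈-map⁻ suc i∈ = (_ , refl) , eq
  inj : ∀ {x y} → Index x → Index y → full (pred (proj₁ x)) ≡ full (pred (proj₁ y)) → x ≡ y
  inj (i∈ , _) (j∈ , _) eq with _ , _ , refl ← ∈-map⁻ suc i∈ | _ , _ , refl ← ∈-map⁻ suc j∈
    with refl ← eq = refl
  onto : ∀ {s} → IsFull s × OfWeight k s → Σ[ x ∈ ℕ × ⊤ ] Index x × full (pred (proj₁ x)) ≡ s
  onto ((N , refl) , eq) =
    (suc N , tt) ,
    (oneTo⁺ (s≤s (subst (N ≤_) (trans (sym (triangle≡ N)) eq) (n≤triangle N))) , eq) , refl

-- The indices of the double sum are i = l + p + 1 and j = l + q + 1; the bound
-- l < min(i, j) says that p and q are natural numbers.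
notchedShapes : ∀ k → Enumerated (λ s → IsNotched s × OfWeight k s) (notchedSeries k)
notchedShapes k = image shape fwd inj onto
  (indexed {P = λ i (j , l , _) → j ∈ oneTo k × l ∈ upTo (i ⊓ j) × notchWeight i j l ≡ k}
    (unique-oneTo k) λ {i} _ →
  indexed {P = λ j (l , _) → l ∈ upTo (i ⊓ j) × notchWeight i j l ≡ k}
    (unique-oneTo k) λ {j} _ →
  indexed {P = λ l (_ : ⊤) → notchWeight i j l ≡ k}
    (Unique.upTo⁺ (i ⊓ j)) λ _ →
  monomial _ k)
  where
  Index : Pred (ℕ × ℕ × ℕ × ⊤) 0ℓ
  Index (i , j , l , _) = i ∈ oneTo k × j ∈ oneTo k × l ∈ upTo (i ⊓ j) × notchWeight i j l ≡ k
  shape : ℕ × ℕ × ℕ × ⊤ → Shape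
  shape (i , j , l , _) = notched l (i ∸ suc l) (j ∸ suc l)
  restore : ∀ {l i} → l < i → l + suc (i ∸ suc l) ≡ i
  restore {l} {i} l<i = trans (+-suc l (i ∸ suc l)) (m+[n∸m]≡n l<i)
  bounds : ∀ {i j l} → l ∈ upTo (i ⊓ j) → l < i × l < j
  bounds {i} {j} l∈ = ⊓-left i j (∈-upTo⁻ l∈) , ⊓-right i j (∈-upTo⁻ l∈)
  fwd : ∀ {x} → Index x → IsNotched (shape x) × OfWeight k (shape x)
  fwd {i , j , l , _} (_ , _ , l∈ , eq) = let (l<i , l<j) = bounds {i} {j} l∈ in
    (_ , _ , _ , refl) , trans (cong₂ (λ i j → notchWeight i j l) (restore l<i) (restore l<j)) eq
  parts : ∀ {l p q l′ p′ q′} → notched l p q ≡ notched l′ p′ q′ → l ≡ l′ × p ≡ p′ × q ≡ q′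
  parts refl = refl , refl , refl
  inj : ∀ {x y} → Index x → Index y → shape x ≡ shape y → x ≡ y
  inj {i , j , l , _} {i′ , j′ , _} (_ , _ , l∈ , _) (_ , _ , l∈′ , _) eq
    with refl , p≡ , q≡ ← parts eq =
    let (l<i , l<j)   = bounds {i} {j} l∈
        (l<i′ , l<j′) = bounds {i′} {j′} l∈′
    in cong₂ (λ i j → i , j , l , tt)
         (trans (sym (restore l<i)) (trans (cong (λ p → l + suc p) p≡) (restore l<i′)))
         (trans (sym (restore l<j)) (trans (cong (λ q → l + suc q) q≡) (restore l<j′)))
  onto : ∀ {s} → IsNotched s × OfWeight k s → Σ[ x ∈ ℕ × ℕ × ℕ × ⊤ ] Index x × shape x ≡ s
  onto ((l , p , q , refl) , eq) =
    (i , j , l , tt) ,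
    ( inRange (≤-trans (n≤triangle i) (triangle≤notchWeightˡ i {j} (m≤m+n l (suc q))))
    , inRange (≤-trans (n≤triangle j) (triangle≤notchWeightʳ j {i} (m≤m+n l (suc p))))
    , ∈-upTo⁺ (⊓-glb (m<m+n l z<s) (m<m+n l z<s)) , eq) ,
    cong₂ (notched l) (gap p) (gap q)
    where
    i = l + suc p
    j = l + suc q
    inRange : ∀ {p} → l + suc p ≤ notchWeight i j l → l + suc p ∈ oneTo k
    inRange {p} ≤w = subst (_∈ oneTo k) (sym (+-suc l p))
      (oneTo⁺ (subst₂ _≤_ (+-suc l p) eq ≤w))
    gap : ∀ p → l + suc p ∸ suc l ≡ p
    gap p = trans (cong (_∸ suc l) (+-suc l p)) (m+n∸m≡n l p)

shapes : ∀ k → Enumerated (OfWeight k) ((fullSeries ⊞ notchedSeries) k)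
shapes k = union (fullShapes k) (notchedShapes k)
  (λ { ((_ , refl) , _) ((_ , _ , _ , ()) , _) })
  ( (λ { {full N} eq → inj₁ ((N , refl) , eq) ; {notched l p q} eq → inj₂ ((l , p , q , refl) , eq) })
  , (λ { (inj₁ (_ , eq)) → eq ; (inj₂ (_ , eq)) → eq }))

permutation-count : ∀ k → HasCardinality (I k (p123 ∷ p231 ∷ [])) ((fullSeries ⊞ notchedSeries) k)
permutation-count k = cardinality (I k (p123 ∷ p231 ∷ []))
  (λ {s} eq → let hs = permutationOf-shape s in
    permutationOf s , shape⇒indecomposable s hs , trans (inversions-shape s hs) eq ,
    shape⇒avoids-123 s hs All.∷ shape⇒avoids-231 s hs All.∷ All.[])
  (λ {s} {t} _ _ π≋σ →
    permutation-shape-unique (PermHasShape-resp-≋ π≋σ (permutationOf-shape s))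
                             (permutationOf-shape t))
  (λ { (π , indec , inv , a123 All.∷ a231 All.∷ All.[]) →
    let (s , hs) = classification π indec a123 a231
    in s , trans (sym (inversions-shape s hs)) inv ,
       λ _ → same-shape⇒≋ (permutationOf-shape s) hs })
  (shapes k)

fountain-count : ∀ k → HasCardinality (RectangularFountains k) ((fullSeries ⊞ notchedSeries) k)
fountain-count k = cardinality (RectangularFountains k)
  (λ {s} eq → let hs = fountainOf-shape s in
    fountainOf s , trans (coinCount-shape s hs) eq , shape⇒rectangle s hs)
  (λ {s} {t} _ _ F≐G →
    fountain-shape-unique F≐G (fountainOf-shape s) (fountainOf-shape t))
  (λ (F , count , rect) →
    let (s , hs) = rectangle⇒shape F rect
    in s , trans (sym (coinCount-shape s hs)) count ,
       λ _ → same-shape⇒≐ (fountainOf-shape s) hs)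
  (shapes k)

theorem12 : Σ[ c ∈ Series ]
    (∀ k → HasCardinality (I k (p123 ∷ p231 ∷ [])) (c k)) ×
    (∀ k → HasCardinality (RectangularFountains k) (c k)) ×
    (Σ[ S ∈ Series ] Σ[ R ∈ (ℕ → Series) ] Σ[ D ∈ Series ]
    (∑≥1 (λ i → x^ (i C 2)) ↦ S) ×
    (∀ i → 1 ≤ i → ∑≥1 (λ j → sumOver (upTo (i ⊓ j)) (λ l →
    x^ (((i + 1) C 2 + (j + 1) C 2) ∸ (l + 1) C 2))) ↦ R i) ×
    (∑≥1 R ↦ D) ×
    (c ≗ S ⊞ D))
theorem12 = fullSeries ⊞ notchedSeries , permutation-count , fountain-count ,
  fullSeries , notchedRow , notchedSeries ,
  fullSeries-sum , (λ i _ → notchedRow-sum i) , notchedSeries-sum , λ _ → refl
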